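{- Let $G$ be a graph of order $n\geq 4$ such that both $G$ and its complement $\overline{G}$ are connected. Then: $md(G)\cdot md(\overline{G})=9$ if $n=4$; $4\leq md(G)\cdot md(\overline{G})\leq 9$ if $n=5$; $3\leq md(G)\cdot md(\overline{G})\leq 10$ if $n=6$; and $1\leq md(G)\cdot md(\overline{G})\leq 2(n-1)$ if $n\geq 7$. Furthermore, the bounds are sharp, i.e., for each such $n$ each of the stated lower and upper bounds is attained by some graph $G$ of order $n$ with $G$ and $\overline{G}$ connected.
   Context: Graphs are finite and simple. An edge-coloring of a graph $G$ is an arbitrary map from $E(G)$ to a finite set of colors (adjacent edges may receive the same color). For two distinct vertices $u,v$ of an edge-colored graph $G$, a monochromatic $uv$-cut is a set $M$ of edges, all of the same color, such that $u$ and $v$ lie in different components of $G-M$. An edge-coloring of $G$ is an $MD$-coloring (monochromatic disconnection coloring) if every two distinct vertices of $G$ are separated by a monochromatic cut. For a connected graph $G$, the monochromatic disconnection number $md(G)$ is the maximum number of colors actually used on $E(G)$ over all $MD$-colorings of $G$. -}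

module Defs where

open import Data.Bool using (Bool; true; false; not; _∧_; T)
open import Data.Bool.Properties using (T?; T-irrelevant)
open import Data.Empty using (⊥-elim)
open import Data.Fin using (Fin; zero; suc; combine; remQuot; finToFun; funToFin)
open import Data.Fin.Properties
  using (_≟_; any?; all?; combine-injective; remQuot-combine; finToFun-funToFin; injective⇒≤)
open import Data.List using (List; []; _∷_; length; filter; allFin; lookup)
open import Data.List.Membership.Propositional using (_∈_)
open import Data.List.Membership.Propositional.Properties
  using (∈-filter⁺; ∈-filter⁻; ∈-allFin; ∈-lookup)
open import Data.List.Properties using (filter-all; length-tabulate)
open import Data.List.Relation.Unary.All as All using (universal)
open import Data.List.Relation.Unary.AllPairs using (_∷_)
open import Data.List.Relation.Unary.Any using (here; there; index)
open import Data.List.Relation.Unary.Any.Properties using (lookup-index)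
open import Data.List.Relation.Unary.Unique.Propositional using (Unique)
open import Data.List.Relation.Unary.Unique.Propositional.Properties
  using (allFin⁺; filter⁺)
open import Data.Nat using (ℕ; zero; suc; _≤_; _*_; z≤n)
open import Data.Nat.Properties using (≤-pred; ≤∧≢⇒<)
open import Data.Product using (Σ; Σ-syntax; ∃; ∃-syntax; _×_; _,_; proj₁; proj₂)
open import Data.Sum using (_⊎_; inj₁; inj₂)
open import Level using (0ℓ)
open import Relation.Binary using (Rel)
open import Relation.Binary.Construct.Closure.ReflexiveTransitive
  using (Star; ε; _◅_; _◅◅_; gmap)
open import Relation.Binary.PropositionalEquality
  using (_≡_; _≢_; refl; sym; trans; cong; cong₂; subst)
open import Relation.Nullary using (¬_; Dec; yes; no; does)
open import Relation.Nullary.Decidable using (map′; ¬?; _×-dec_; _⊎-dec_; _→-dec_; dec-true; dec-false)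

private
  variable
    n k : ℕ

record Graph (n : ℕ) : Set where
  field
    adj     : Fin n → Fin n → Bool
    symm    : ∀ u v → adj u v ≡ adj v u
    irrefl  : ∀ v → adj v v ≡ false

  infix 4 _~_
  _~_ : Rel (Fin n) 0ℓ
  u ~ v = T (adj u v)

Connected : Graph n → Set
Connected G = ∀ u v → Star _~_ u v
  where open Graph G

∁ : Graph n → Graph n
∁ {n} G = record { adj = adj′ ; symm = symm′ ; irrefl = irrefl′ }
  where
  open Graph G
  adj′ : Fin n → Fin n → Bool
  adj′ u v = not (does (u ≟ v)) ∧ not (adj u v)

  ≟-symm : (u v : Fin n) → does (u ≟ v) ≡ does (v ≟ u)
  ≟-symm u v with u ≟ v
  ... | yes u≡v = sym (dec-true (v ≟ u) (sym u≡v))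
  ... | no  u≢v = sym (dec-false (v ≟ u) (λ v≡u → u≢v (sym v≡u)))

  symm′ : ∀ u v → adj′ u v ≡ adj′ v u
  symm′ u v = cong₂ (λ a b → not a ∧ not b) (≟-symm u v) (symm u v)

  irrefl′ : ∀ v → adj′ v v ≡ false
  irrefl′ v = cong (λ a → not a ∧ not (adj v v)) (dec-true (v ≟ v) refl)

-- Maps E(G) → A.  An edge {u , v} has the two presentations u ~ v and v ~ u,
-- on which the map must agree; each presentation is a proof-irrelevant T _.
record EdgeMap (G : Graph n) (A : Set) : Set where
  open Graph G
  field
    at      : ∀ {u v} → u ~ v → A
    at-symm : ∀ {u v} (e : u ~ v) (e′ : v ~ u) → at e ≡ at e′

open EdgeMap public

EdgeColoring : Graph n → ℕ → Set
EdgeColoring G k = EdgeMap G (Fin k)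

EdgeSet : Graph n → Set
EdgeSet G = EdgeMap G Bool

module _ {n : ℕ} {G : Graph n} where
  open Graph G

  -- Adjacency in G − M.
  Without : EdgeSet G → Rel (Fin n) 0ℓ
  Without M u v = Σ[ e ∈ u ~ v ] ¬ T (at M e)

  Monochromatic : EdgeColoring G k → EdgeSet G → Set
  Monochromatic c M = ∀ {u v x y} (e : u ~ v) (f : x ~ y) →
    T (at M e) → T (at M f) → at c e ≡ at c f

  IsMonochromaticCut : EdgeColoring G k → Fin n → Fin n → EdgeSet G → Set
  IsMonochromaticCut c u v M = Monochromatic c M × ¬ Star (Without M) u v

  IsMDColoring : EdgeColoring G k → Set
  IsMDColoring c = ∀ u v → u ≢ v → ∃[ M ] IsMonochromaticCut c u v M

  Used : EdgeColoring G k → Fin k → Set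
  Used c i = ∃[ u ] ∃[ v ] Σ[ e ∈ u ~ v ] at c e ≡ i

  Σ~? : ∀ {u v} {P : u ~ v → Set} → (∀ e → Dec (P e)) → Dec (Σ (u ~ v) P)
  Σ~? {u} {v} {P} P? with T? (adj u v)
  ... | no ¬e = no (λ p → ¬e (proj₁ p))
  ... | yes e = map′ (e ,_) (λ (e′ , p) → subst P (T-irrelevant e′ e) p) (P? e)

  used? : (c : EdgeColoring G k) (i : Fin k) → Dec (Used c i)
  used? c i = any? λ u → any? λ v → Σ~? λ e → at c e ≟ i

  numColors : EdgeColoring G k → ℕ
  numColors {k} c = length (filter (used? c) (allFin k))

IsMd : Graph n → ℕ → Set
IsMd G m =
    (∃[ k ] Σ[ c ∈ EdgeColoring G k ] IsMDColoring c × numColors c ≡ m)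
  × (∀ k (c : EdgeColoring G k) → IsMDColoring c → numColors c ≤ m)

-- Reachability along a decidable relation on Fin n is decidable:
-- Via xs u v is reachability with all interior vertices taken from xs.
private module Reach {n : ℕ} {R : Rel (Fin n) 0ℓ} (R? : ∀ u v → Dec (R u v)) where

  Via : List (Fin n) → Rel (Fin n) 0ℓ
  Via []       u v = u ≡ v ⊎ R u v
  Via (x ∷ xs) u v = Via xs u v ⊎ (Via xs u x × Via xs x v)

  via? : ∀ xs u v → Dec (Via xs u v)
  via? []       u v = (u ≟ v) ⊎-dec R? u v
  via? (x ∷ xs) u v = via? xs u v ⊎-dec (via? xs u x ×-dec via? xs x v)

  sound : ∀ xs {u v} → Via xs u v → Star R u v
  sound []       (inj₁ refl)    = ε
  sound []       (inj₂ r)       = r ◅ ε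
  sound (x ∷ xs) (inj₁ p)       = sound xs p
  sound (x ∷ xs) (inj₂ (p , q)) = sound xs p ◅◅ sound xs q

  base : ∀ xs {u v} → u ≡ v ⊎ R u v → Via xs u v
  base []       p = p
  base (x ∷ xs) p = inj₁ (base xs p)

  join : ∀ xs {u w v} → w ∈ xs → Via xs u w → Via xs w v → Via xs u v
  join (x ∷ xs) (here refl) p q = inj₂ (into p , out q)
    where
    into : ∀ {u} → Via (x ∷ xs) u x → Via xs u x
    into (inj₁ p)       = p
    into (inj₂ (p , _)) = p
    out : ∀ {v} → Via (x ∷ xs) x v → Via xs x v
    out (inj₁ q)       = q
    out (inj₂ (_ , q)) = q
  join (x ∷ xs) (there w∈) (inj₁ p)       (inj₁ q)       = inj₁ (join xs w∈ p q)
  join (x ∷ xs) (there w∈) (inj₁ p)       (inj₂ (q , r)) = inj₂ (join xs w∈ p q , r)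
  join (x ∷ xs) (there w∈) (inj₂ (o , p)) (inj₁ q)       = inj₂ (o , join xs w∈ p q)
  join (x ∷ xs) (there w∈) (inj₂ (o , _)) (inj₂ (_ , r)) = inj₂ (o , r)

  complete : ∀ {u v} → Star R u v → Via (allFin n) u v
  complete ε       = base (allFin n) (inj₁ refl)
  complete (r ◅ s) = join (allFin n) (∈-allFin _) (base (allFin n) (inj₂ r)) (complete s)

  star? : ∀ u v → Dec (Star R u v)
  star? u v = map′ (sound (allFin n)) complete (via? (allFin n) u v)

private
  lookup-injective : ∀ {xs : List (Fin n)} → Unique xs →
                     ∀ i j → lookup xs i ≡ lookup xs j → i ≡ j
  lookup-injective (_ ∷ _)     zero    zero    _ = refl
  lookup-injective (x∉xs ∷ _)  zero    (suc j) p = ⊥-elim (All.lookup x∉xs (∈-lookup j) p)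
  lookup-injective (x∉xs ∷ _)  (suc i) zero    p = ⊥-elim (All.lookup x∉xs (∈-lookup i) (sym p))
  lookup-injective (_ ∷ xs!)   (suc i) (suc j) p = cong suc (lookup-injective xs! i j p)

private module Existence {n : ℕ} (G : Graph n) where
  open Graph G

  flip~ : ∀ {u v} → u ~ v → v ~ u
  flip~ {u} {v} = subst T (symm u v)

  Same : ∀ {k l} → EdgeColoring G k → EdgeColoring G l → Set
  Same c d = ∀ {u v x y} (e : u ~ v) (f : x ~ y) → at c e ≡ at c f → at d e ≡ at d f

  md-resp : ∀ {k l} (c : EdgeColoring G k) (d : EdgeColoring G l) →
            Same c d → IsMDColoring c → IsMDColoring d
  md-resp c d same md u v u≢v with md u v u≢v
  ... | M , mono , cut = M , (λ e f p q → same e f (mono e f p q)) , cut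

  class : EdgeColoring G k → Fin k → EdgeSet G
  class c i = record
    { at      = λ e → does (at c e ≟ i)
    ; at-symm = λ e e′ → cong (λ j → does (j ≟ i)) (at-symm c e e′)
    }

  ∈class⁻ : (c : EdgeColoring G k) (i : Fin k) → ∀ {u v} (e : u ~ v) →
            T (at (class c i) e) → at c e ≡ i
  ∈class⁻ c i e t with at c e ≟ i
  ... | yes p = p

  ∈class⁺ : (c : EdgeColoring G k) (i : Fin k) → ∀ {u v} (e : u ~ v) →
            at c e ≡ i → T (at (class c i) e)
  ∈class⁺ c i e p with at c e ≟ i
  ... | yes _ = _
  ... | no ¬p = ⊥-elim (¬p p)

  ClassCut : EdgeColoring G k → Fin n → Fin n → Fin k → Set
  ClassCut c u v i = ¬ Star (Without (class c i)) u v

  classCut⁺ : (c : EdgeColoring G (suc k)) → ∀ u v →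
              ∃[ M ] IsMonochromaticCut c u v M → ∃[ i ] ClassCut c u v i
  classCut⁺ {k} c u v (M , mono , cut)
    with any? (λ x → any? λ y → Σ~? {G = G} {x} {y} λ e → T? (at M e))
  ... | yes (x , y , e , e∈M) = at c e , λ s → cut (gmap (λ w → w) mono′ s)
    where
    mono′ : ∀ {a b} → Without (class c (at c e)) a b → Without M a b
    mono′ (f , f∉) = f , λ f∈M → f∉ (∈class⁺ c _ f (mono f e f∈M e∈M))
  ... | no none = zero , λ s → cut (gmap (λ w → w) any-edge s)
    where
    any-edge : ∀ {a b} → Without (class c zero) a b → Without M a b
    any-edge (f , _) = f , λ f∈M → none (_ , _ , f , f∈M)

  classCut⁻ : (c : EdgeColoring G k) → ∀ u v →
              ∃[ i ] ClassCut c u v i → ∃[ M ] IsMonochromaticCut c u v M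
  classCut⁻ c u v (i , cut) = class c i ,
    (λ e f p q → trans (∈class⁻ c i e p) (sym (∈class⁻ c i f q))) , cut

  md? : (c : EdgeColoring G (suc k)) → Dec (IsMDColoring c)
  md? c = all? λ u → all? λ v → ¬? (u ≟ v) →-dec
    map′ (classCut⁻ c u v) (classCut⁺ c u v)
      (any? λ i → ¬? (Reach.star? (λ a b → Σ~? {G = G} λ e → ¬? (T? _)) u v))

  Full : ℕ → Set
  Full m = Σ[ c ∈ EdgeColoring G m ] IsMDColoring c × (∀ i → Used c i)

  full-num : (c : EdgeColoring G k) → (∀ i → Used c i) → numColors c ≡ k
  full-num {k} c full = trans
    (cong length (filter-all (used? c) (universal full (allFin k))))
    (length-tabulate (λ i → i))

  -- Renumbering so that exactly the used colors remain.
  compress : (c : EdgeColoring G k) → IsMDColoring c → Full (numColors c)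
  compress {k} c md = d , md-resp c d same md , full
    where
    colors : List (Fin k)
    colors = filter (used? c) (allFin k)

    colors! : Unique colors
    colors! = filter⁺ (used? c) (allFin⁺ k)

    e∈ : ∀ {u v} (e : u ~ v) → at c e ∈ colors
    e∈ e = ∈-filter⁺ (used? c) (∈-allFin _) (_ , _ , e , refl)

    lk : ∀ {u v} (e : u ~ v) → at c e ≡ lookup colors (index (e∈ e))
    lk e = lookup-index (e∈ e)

    same′ : ∀ {u v x y} (e : u ~ v) (f : x ~ y) →
            at c e ≡ at c f → index (e∈ e) ≡ index (e∈ f)
    same′ e f p = lookup-injective colors! _ _ (trans (sym (lk e)) (trans p (lk f)))

    d : EdgeColoring G (numColors c)
    d = record { at = λ e → index (e∈ e) ; at-symm = λ e e′ → same′ e e′ (at-symm c e e′) }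

    same : Same c d
    same = same′

    full : ∀ i → Used d i
    full i with proj₂ (∈-filter⁻ (used? c) {xs = allFin k} (∈-lookup {xs = colors} i))
    ... | u , v , e , p = u , v , e ,
      lookup-injective colors! _ _ (trans (sym (lk e)) p)

  full≤ : ∀ {m} → Full m → m ≤ n * n
  full≤ (c , _ , full) = injective⇒≤ {f = rep} inj
    where
    rep : Fin _ → Fin (n * n)
    rep i = combine (proj₁ (full i)) (proj₁ (proj₂ (full i)))

    eq : ∀ {u v x y} (e : u ~ v) (f : x ~ y) → u ≡ x → v ≡ y → at c e ≡ at c f
    eq e f refl refl = cong (at c) (T-irrelevant e f)

    inj : ∀ {i j} → rep i ≡ rep j → i ≡ j
    inj {i} {j} p with full i | full j
    ... | u , v , e , refl | x , y , f , refl =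
      let (u≡x , v≡y) = combine-injective u v x y p in eq e f u≡x v≡y

  -- Colorings with suc k colors are read off from tables Fin (n * n) → Fin (suc k).
  Consistent : (Fin (n * n) → Fin k) → Set
  Consistent t = ∀ (u v : Fin n) → t (combine u v) ≡ t (combine v u)

  fromTable : (t : Fin (n * n) → Fin k) → Consistent t → EdgeColoring G k
  fromTable t con = record
    { at = λ {u} {v} _ → t (combine u v) ; at-symm = λ {u} {v} _ _ → con u v }

  entry : EdgeColoring G (suc k) → Fin n → Fin n → Fin (suc k)
  entry c u v with T? (adj u v)
  ... | yes e = at c e
  ... | no  _ = zero

  entry-at : (c : EdgeColoring G (suc k)) → ∀ {u v} (e : u ~ v) → entry c u v ≡ at c e
  entry-at c {u} {v} e with T? (adj u v)
  ... | yes e′ = cong (at c) (T-irrelevant e′ e)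
  ... | no ¬e  = ⊥-elim (¬e e)

  entry-symm : (c : EdgeColoring G (suc k)) → ∀ u v → entry c u v ≡ entry c v u
  entry-symm c u v with T? (adj u v) | T? (adj v u)
  ... | yes e | yes f = at-symm c e f
  ... | yes e | no ¬f = ⊥-elim (¬f (flip~ e))
  ... | no ¬e | yes f = ⊥-elim (¬e (flip~ f))
  ... | no _  | no _  = refl

  TableFull : (Fin (n * n) → Fin k) → Set
  TableFull t = Σ[ con ∈ Consistent t ]
    IsMDColoring (fromTable t con) × (∀ i → Used (fromTable t con) i)

  tableFull? : (t : Fin (n * n) → Fin (suc k)) → Dec (TableFull t)
  tableFull? t with all? (λ (u : Fin n) → all? λ (v : Fin n) → t (combine u v) ≟ t (combine v u))
  ... | no ¬con = no (λ p → ¬con (proj₁ p))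
  ... | yes con = map′ (con ,_) back
          (md? (fromTable t con) ×-dec all? (used? (fromTable t con)))
    where
    back : TableFull t →
           IsMDColoring (fromTable t con) × (∀ i → Used (fromTable t con) i)
    back (con′ , md , full) =
      md-resp (fromTable t con′) (fromTable t con) (λ _ _ p → p) md , full

  module _ {k : ℕ} (p : Full (suc k)) where
    private
      c = proj₁ p

      f : Fin (n * n) → Fin (suc k)
      f i = entry c (proj₁ (remQuot {n} n i)) (proj₂ (remQuot {n} n i))

      t : Fin (n * n) → Fin (suc k)
      t = finToFun (funToFin f)

      t-entry : ∀ (u v : Fin n) → t (combine u v) ≡ entry c u v
      t-entry u v = trans (finToFun-funToFin f (combine u v))
        (cong (λ q → entry c (proj₁ q) (proj₂ q)) (remQuot-combine {n} {n} u v))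

      con : Consistent t
      con u v = trans (t-entry u v) (trans (entry-symm c u v) (sym (t-entry v u)))

      t-at : ∀ {u v} (e : u ~ v) → at (fromTable t con) e ≡ at c e
      t-at e = trans (t-entry _ _) (entry-at c e)

    toTable : ∃[ i ] TableFull (finToFun {suc k} {n * n} i)
    toTable = funToFin f , con ,
      md-resp c (fromTable t con)
        (λ e e′ q → trans (t-at e) (trans q (sym (t-at e′)))) (proj₁ (proj₂ p)) ,
      (λ i → let (u , v , e , q) = proj₂ (proj₂ p) i in u , v , e , trans (t-at e) q)

  full? : ∀ m → Dec (Full (suc m))
  full? m = map′ (λ (i , con , md , full) → fromTable (finToFun i) con , md , full) toTable
    (any? λ i → tableFull? (finToFun i))

  mono : EdgeColoring G 1
  mono = record { at = λ _ → zero ; at-symm = λ _ _ → refl }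

  mono-md : IsMDColoring mono
  mono-md u v u≢v = class mono zero , (λ _ _ _ _ → refl) ,
    λ { ε → u≢v refl ; ((_ , e∉) ◅ _) → e∉ _ }

  Max : Set
  Max = ∃[ m ] Full m × (∀ l → Full l → l ≤ m)

  search : ∀ b → (∀ l → Full l → l ≤ b) → Max
  search zero    ub = 0 , subst Full (lemma (numColors mono) (ub _ p)) p , ub
    where
    p = compress mono mono-md
    lemma : ∀ x → x ≤ 0 → x ≡ 0
    lemma zero z≤n = refl
  search (suc b) ub with full? b
  ... | yes p = suc b , p , ub
  ... | no ¬p = search b λ l q →
          ≤-pred (≤∧≢⇒< (ub l q) (λ l≡ → ¬p (subst Full l≡ q)))

  md-exists′ : ∃ (IsMd G)
  md-exists′ with search (n * n) (λ _ → full≤)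
  ... | m , (c , md , full) , max =
    m , (m , c , md , full-num c full) , λ k d md′ → max _ (compress d md′)

-- Every graph has an MD-coloring (use a single color), so the maximum exists
-- without assuming connectedness.  Opaque, so that the exhaustive search behind
-- it is never unfolded; md is characterized by md-spec.
opaque
  md-exists : (G : Graph n) → ∃ (IsMd G)
  md-exists = Existence.md-exists′

md : Graph n → ℕ
md G = proj₁ (md-exists G)

md-spec : (G : Graph n) → IsMd G (md G)
md-spec G = proj₂ (md-exists G)

module Submission where

-- An MD-coloring yields, for each color i, the equivalence "joined by a path
-- avoiding color i".  Hence triangles are monochromatic, opposite edges of a
-- 4-cycle agree, every color of a closed walk occurs on it twice, and a coloring
-- with k colors is the same as an injection of the vertices into ℕᵏ under which
-- adjacent vertices differ in exactly one coordinate.  Such injections give all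
-- lower bounds.
--
-- Upper bounds: a connected graph has at most n − 1 colors (grow a spanning tree).
-- For n ≥ 5 and MD-colorings of a graph (red) and its complement (blue), one of the
-- two uses at most 2 colors, or both use at most 3; no connectedness is needed,
-- so one can induct by deleting a vertex x.  If no color is lost, nothing is to be
-- shown.  If a red color i occurs at x only, let A be the component of x in red
-- without i.  All pairs between A ∖ {x} and the complement of A are blue, which
-- forces few blue colors unless x or a neighbor of it has only one red neighbor,
-- and that case is treated directly.  Together, the product is at most
-- max (9, 2 (n − 1)).

open import Data.Bool using (Bool; true; false; not; _∧_; _∨_; T; if_then_else_)
open import Data.Bool.Properties as Bool using (T?; T-irrelevant; T-∧; T-∨; ∨-comm)
open import Data.Empty using (⊥; ⊥-elim)
open import Data.Fin as Fin using (Fin; zero; suc; toℕ; splitAt; _↑ˡ_)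
open import Data.Fin.Patterns
open import Data.Fin.Properties
  using (_≟_; any?; all?; toℕ-injective; suc-injective; <-cmp; injective⇒≤; sequence; splitAt-↑ˡ)
open import Data.List
  using (List; []; _∷_; _++_; length; lookup; tabulate; map; filter; allFin; cartesianProduct;
         concatMap; foldr)
import Data.List.Membership.DecPropositional as DecMembership
open import Data.List.Membership.Propositional using (_∈_; _∉_; find)
open import Data.List.Membership.Propositional.Properties
  using (∈-tabulate⁺; ∈-lookup; ∈-filter⁺; ∈-filter⁻; ∈-map⁺; ∈-map⁻; ∈-allFin;
         ∈-cartesianProduct⁺)
open import Data.List.Properties using (length-map; length-tabulate; filter-all)
open import Data.List.Relation.Unary.All as All using (All; []; _∷_; universal)
import Data.List.Relation.Unary.All.Properties as All
open import Data.List.Relation.Unary.AllPairs using ([]; _∷_)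
open import Data.List.Relation.Unary.Any as Any using (Any; here; there; index)
open import Data.List.Relation.Unary.Any.Properties using (lookup-index)
open import Data.List.Relation.Unary.Unique.Propositional using (Unique)
open import Data.List.Relation.Unary.Unique.Propositional.Properties using (allFin⁺; filter⁺; map⁺)
open import Data.Nat as ℕ
  using (ℕ; zero; suc; _≤_; _<_; _+_; _*_; _∸_; z≤n; s≤s; _⊔_; _≡ᵇ_; _≤ᵇ_)
open import Data.Nat.Properties as ℕ using (≤-refl; ≤-trans)
open import Data.Product using (Σ-syntax; ∃-syntax; _×_; _,_; proj₁; proj₂)
open import Data.Product.Properties using (≡-dec)
open import Data.Sum using (_⊎_; inj₁; inj₂; [_,_])
open import Data.Unit using (⊤; tt)
open import Data.Vec as Vec using (Vec; []; _∷_)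
open import Data.Vec.Properties using (lookup∘tabulate)
open import Defs
open import Effect.Monad using (RawMonad)
open import Function using (_∘_; case_of_; const; Equivalence)
open import Relation.Binary using (tri<; tri≈; tri>)
open import Relation.Binary.Construct.Closure.ReflexiveTransitive
  using (Star; ε; _◅_; _◅◅_; reverse; gmap)
open import Relation.Binary.PropositionalEquality
  using (_≡_; _≢_; refl; sym; trans; cong; cong₂; subst; subst₂; ≢-sym)
open import Relation.Nullary using (¬_; Dec; yes; no; does)
open import Relation.Nullary.Decidable
  using (decidable-stable; ¬¬-excluded-middle; _×-dec_; _⊎-dec_; _→-dec_; ¬?; from-yes; map′;
         dec-true; dec-false)
open import Relation.Nullary.Negation using (¬¬-Monad)
open DecMembership ℕ._≟_ using (_∈?_)

-- `MDStructure` is shaped for the induction: its axioms speak only of end points, so they pass to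
-- any subset of the vertices. The relations `_⊢_≈_` are not assumed decidable there; the induction
-- therefore runs under a double negation, which is removed only at the numerical inequalities for
-- `md`. The inductive step repeatedly needs a vertex outside five given ones, hence starts at order
-- 6 and leaves order 5 to an exhaustive check. Since 9 exceeds 2 (n - 1) exactly for n at most 5,
-- order 5 keeps the bound 9, attained by a self-complementary graph with 3 · 3 colors. The lower
-- bounds valid for all graphs of order 4, 5, 6 come from a search through all graphs, fed with a
-- few placements of the vertices in ℕᵏ. From order 7 on only the trivial bound 1 remains. It is
-- attained by copying one vertex of a seven-vertex graph for which triangles and 4-cycles force a
-- single color, both on the graph and on its complement.

private
  variable
    k m n : ℕ

-- MD-colorings and short cycles

pattern 1st = here refl
pattern 2nd = there 1st
pattern 3rd = there 2nd

∈-stable : ∀ {x : ℕ} {L} → ¬ ¬ (x ∈ L) → x ∈ L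
∈-stable {x} {L} = decidable-stable (x ∈? L)

relist : ∀ {x : ℕ} {K L} → All (_∈ L) K → x ∈ K → x ∈ L
relist {L = L} ps x∈ = All.lookup {P = _∈ L} ps x∈

opaque
  third : (k l : Fin 3) → ∃[ j ] j ≢ k × j ≢ l
  third = from-yes (all? {n = 3} λ k → all? {n = 3} λ l → any? {n = 3} λ j →
    ¬? (j ≟ k) ×-dec ¬? (j ≟ l))

-- An MD-coloring seen through the relations i ⊢ u ≈ v, "u and v are joined by a
-- path avoiding color i"; col is only meaningful on adjacent pairs.
record MDStructure (n : ℕ) : Set₁ where
  infix 4 _~_ _~?_ _⊢_≈_
  field
    _~_     : Fin n → Fin n → Set
    _~?_    : ∀ u v → Dec (u ~ v)
    ~-sym   : ∀ {u v} → u ~ v → v ~ u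
    ~⇒≢     : ∀ {u v} → u ~ v → u ≢ v
    col     : Fin n → Fin n → ℕ
    col-sym : ∀ u v → col u v ≡ col v u
    _⊢_≈_   : ℕ → Fin n → Fin n → Set
    ≈-refl  : ∀ {i u} → i ⊢ u ≈ u
    ≈-sym   : ∀ {i u v} → i ⊢ u ≈ v → i ⊢ v ≈ u
    ≈-trans : ∀ {i u v w} → i ⊢ u ≈ v → i ⊢ v ≈ w → i ⊢ u ≈ w
    ≈-edge  : ∀ {i u v} → u ~ v → col u v ≢ i → i ⊢ u ≈ v
    ≈-sep   : ∀ {u v} → u ≢ v → ¬ (∀ i → i ⊢ u ≈ v)

  Covers : List ℕ → Set
  Covers L = ∀ u v → u ~ v → col u v ∈ L

  AtMost : ℕ → Set
  AtMost m = Σ[ L ∈ List ℕ ] length L ≤ m × Covers L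

  col-flip : ∀ {u v L} → col v u ∈ L → col u v ∈ L
  col-flip {u} {v} {L} = subst (_∈ L) (col-sym v u)

  -- The edge itself joins u and v avoiding every other color; if they were joined avoiding its own
  -- color too, no color would separate them.
  edge-sep : ∀ {u v} → u ~ v → ¬ (col u v ⊢ u ≈ v)
  edge-sep {u} {v} e p = ≈-sep (~⇒≢ e) joined
    where
    joined : ∀ i → i ⊢ u ≈ v
    joined i with col u v ℕ.≟ i
    ... | yes refl = p
    ... | no ≢i    = ≈-edge e ≢i

  ≈-edge′ : ∀ {i u v} → u ~ v → col v u ≢ i → i ⊢ u ≈ v
  ≈-edge′ {i} {u} {v} e ≢i = ≈-edge e (subst (_≢ i) (col-sym v u) ≢i)

  -- If u v and v w differ, u w differs from one of them, and the ends of that one are joined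
  -- through the other two sides, against `edge-sep`.
  triangle : ∀ {u v w} → u ~ v → v ~ w → u ~ w → col u v ≡ col v w
  triangle {u} {v} {w} uv vw uw with col u v ℕ.≟ col v w | col u w ℕ.≟ col u v
  ... | yes p | _      = p
  ... | no ¬p | no ¬q  =
    ⊥-elim (edge-sep uv (≈-trans (≈-edge uw ¬q) (≈-edge′ (~-sym vw) (¬p ∘ sym))))
  ... | no ¬p | yes q  =
    ⊥-elim (edge-sep vw (≈-trans (≈-edge′ (~-sym uv) ¬p)
                                 (≈-edge uw (¬p ∘ trans (sym q)))))

  triangle′ : ∀ {u v w} → u ~ v → v ~ w → u ~ w → col u v ≡ col u w
  triangle′ uv vw uw = trans (col-sym _ _) (triangle (~-sym uv) uw vw)

  -- Every color on the cycle occurs on it twice. If a ≢ c, this leaves two equal adjacent pairs,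
  -- either b = a, d = c or d = a, b = c. Then a diagonal is joined avoiding any given color, along
  -- one half of the cycle or the other.
  square : ∀ {u v w z} → u ~ v → v ~ w → w ~ z → z ~ u → u ≢ w → v ≢ z →
           col u v ≡ col w z
  square {u} {v} {w} {z} uv vw wz zu u≢w v≢z =
    decidable-stable (_ ℕ.≟ _) distinct
    where
    a = col u v
    b = col v w
    c = col w z
    d = col z u

    distinct : ¬ ¬ a ≡ c
    distinct a≢c with b ℕ.≟ a | d ℕ.≟ a
    ... | no b≢a | no d≢a = edge-sep uv
      (≈-trans (≈-edge′ (~-sym zu) d≢a)
        (≈-trans (≈-edge′ (~-sym wz) (a≢c ∘ sym)) (≈-edge′ (~-sym vw) b≢a)))
    ... | yes b≡a | _ with d ℕ.≟ c
    ...   | no d≢c = edge-sep wz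
      (≈-trans (≈-edge′ (~-sym vw) (a≢c ∘ trans (sym b≡a)))
        (≈-trans (≈-edge′ (~-sym uv) a≢c) (≈-edge′ (~-sym zu) d≢c)))
    ...   | yes d≡c = ≈-sep u≢w joined
      where
      joined : ∀ i → i ⊢ u ≈ w
      joined i with a ℕ.≟ i
      ... | no a≢i   = ≈-trans (≈-edge uv a≢i) (≈-edge vw (a≢i ∘ trans (sym b≡a)))
      ... | yes refl = ≈-trans (≈-edge′ (~-sym zu) (a≢c ∘ sym ∘ trans (sym d≡c)))
                               (≈-edge′ (~-sym wz) (a≢c ∘ sym))
    distinct a≢c | no b≢a | yes d≡a with b ℕ.≟ c
    ...   | no b≢c = edge-sep wz
      (≈-trans (≈-edge′ (~-sym vw) b≢c)
        (≈-trans (≈-edge′ (~-sym uv) a≢c) (≈-edge′ (~-sym zu) (a≢c ∘ trans (sym d≡a)))))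
    ...   | yes b≡c = ≈-sep v≢z joined
      where
      joined : ∀ i → i ⊢ v ≈ z
      joined i with a ℕ.≟ i
      ... | no a≢i   = ≈-trans (≈-edge′ (~-sym uv) a≢i)
                               (≈-edge′ (~-sym zu) (a≢i ∘ trans (sym d≡a)))
      ... | yes refl = ≈-trans (≈-edge vw (b≢a)) (≈-edge wz (a≢c ∘ sym))

  -- Every color of a closed walk occurs on it twice; the vertices may coincide.
  pentagon : ∀ {u v w y z} → u ~ v → v ~ w → w ~ y → y ~ z → z ~ u →
             ∃[ a ] ∃[ b ] (let L = a ∷ b ∷ [] in
               col u v ∈ L × col v w ∈ L × col w y ∈ L × col y z ∈ L × col z u ∈ L)
  pentagon {u} {v} {w} {y} {z} uv vw wy yz zu =
    conclude (twice uv vw wy yz zu) (twice vw wy yz zu uv) (twice wy yz zu uv vw)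
             (twice yz zu uv vw wy) (twice zu uv vw wy yz)
    where
    twice : ∀ {u v w y z} → u ~ v → v ~ w → w ~ y → y ~ z → z ~ u →
            col u v ∈ col v w ∷ col w y ∷ col y z ∷ col z u ∷ []
    twice {u} {v} {w} {y} {z} uv vw wy yz zu = ∈-stable λ a∉ → edge-sep uv
      (≈-trans (≈-edge′ (~-sym zu) (λ e → a∉ (there (there (there (here (sym e)))))))
        (≈-trans (≈-edge′ (~-sym yz) (λ e → a∉ (there (there (here (sym e))))))
          (≈-trans (≈-edge′ (~-sym wy) (λ e → a∉ (there (here (sym e)))))
                   (≈-edge′ (~-sym vw) (λ e → a∉ (here (sym e)))))))

    -- Here x already accounts for two edges of the walk. Any value other than x must occur at least
    -- twice among p, q, r, so there is at most one such value.
    rest : ∀ {x p q r : ℕ} → p ∈ x ∷ q ∷ r ∷ [] → q ∈ x ∷ p ∷ r ∷ [] → r ∈ x ∷ p ∷ q ∷ [] →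
           ∃[ b ] (let L = x ∷ b ∷ [] in p ∈ L × q ∈ L × r ∈ L)
    rest 1st 1st _ = _ , 1st , 1st , 2nd
    rest 1st 2nd _ = _ , 1st , 1st , 2nd
    rest 1st 3rd _ = _ , 1st , 2nd , 2nd
    rest 2nd _ 1st = _ , 2nd , 2nd , 1st
    rest 2nd _ 2nd = _ , 2nd , 2nd , 2nd
    rest 2nd _ 3rd = _ , 2nd , 2nd , 2nd
    rest 3rd 1st _ = _ , 2nd , 1st , 2nd
    rest 3rd 2nd _ = _ , 2nd , 2nd , 2nd
    rest 3rd 3rd _ = _ , 2nd , 2nd , 2nd

    conclude : ∀ {a b c d e : ℕ} →
      a ∈ b ∷ c ∷ d ∷ e ∷ [] → b ∈ c ∷ d ∷ e ∷ a ∷ [] → c ∈ d ∷ e ∷ a ∷ b ∷ [] →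
      d ∈ e ∷ a ∷ b ∷ c ∷ [] → e ∈ a ∷ b ∷ c ∷ d ∷ [] →
      ∃[ p ] ∃[ q ] (let L = p ∷ q ∷ [] in a ∈ L × b ∈ L × c ∈ L × d ∈ L × e ∈ L)
    conclude 1st b c d e
      with rest (relist (2nd ∷ 3rd ∷ 1st ∷ 1st ∷ []) c)
                (relist (3rd ∷ 1st ∷ 1st ∷ 2nd ∷ []) d)
                (relist (1st ∷ 1st ∷ 2nd ∷ 3rd ∷ []) e)
    ... | q , c∈ , d∈ , e∈ = _ , q , 1st , 1st , c∈ , d∈ , e∈
    conclude 2nd b c d e
      with rest (relist (1st ∷ 2nd ∷ 3rd ∷ 1st ∷ []) b)
                (relist (3rd ∷ 1st ∷ 2nd ∷ 1st ∷ []) d)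
                (relist (1st ∷ 2nd ∷ 1st ∷ 3rd ∷ []) e)
    ... | q , b∈ , d∈ , e∈ = _ , q , 1st , b∈ , 1st , d∈ , e∈
    conclude 3rd b c d e
      with rest (relist (2nd ∷ 1st ∷ 3rd ∷ 1st ∷ []) b)
                (relist (1st ∷ 3rd ∷ 1st ∷ 2nd ∷ []) c)
                (relist (1st ∷ 2nd ∷ 3rd ∷ 1st ∷ []) e)
    ... | q , b∈ , c∈ , e∈ = _ , q , 1st , b∈ , c∈ , 1st , e∈
    conclude (there 3rd) b c d e
      with rest (relist (2nd ∷ 3rd ∷ 1st ∷ 1st ∷ []) b)
                (relist (3rd ∷ 1st ∷ 1st ∷ 2nd ∷ []) c)
                (relist (1st ∷ 1st ∷ 2nd ∷ 3rd ∷ []) d)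
    ... | q , b∈ , c∈ , d∈ = _ , q , 1st , b∈ , c∈ , d∈ , 1st

  -- 4-cycles equate only disjoint edges, and K₂,₂ alone admits two colors. With a third vertex on
  -- one side, p q₁ and p q₂ are both disjoint from p′ q₃, which links edges sharing an end.
  biclique : (P Q : Fin n → Set) → (∀ {u v} → P u → Q v → u ~ v) →
             ∀ {p p′ q₁ q₂ q₃} → P p → P p′ → Q q₁ → Q q₂ → Q q₃ →
             p ≢ p′ → q₁ ≢ q₂ → q₁ ≢ q₃ → q₂ ≢ q₃ →
             ∀ {u v} → P u → Q v → col u v ≡ col p q₁
  biclique P Q edge {p} {p′} {q₁} {q₂} {q₃} Pp Pp′ Q₁ Q₂ Q₃ p≢p′ q₁≢q₂ q₁≢q₃ q₂≢q₃ {u} {v} Pu Qv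
    = from-β (u ≟ p) (v ≟ q₁)
    where
    opposite : ∀ {u u′ v v′} → P u → P u′ → Q v → Q v′ → u ≢ u′ → v ≢ v′ → col u v ≡ col u′ v′
    opposite Pu Pu′ Qv Qv′ u≢u′ v≢v′ =
      square (edge Pu Qv) (~-sym (edge Pu′ Qv)) (edge Pu′ Qv′) (~-sym (edge Pu Qv′))
        u≢u′ v≢v′

    p′q₃ : col p′ q₃ ≡ col p q₁
    p′q₃ = opposite Pp′ Pp Q₃ Q₁ (p≢p′ ∘ sym) (q₁≢q₃ ∘ sym)

    pq₂ : col p q₂ ≡ col p q₁
    pq₂ = trans (opposite Pp Pp′ Q₂ Q₃ p≢p′ q₂≢q₃) p′q₃

    p′q₁ : col p′ q₁ ≡ col p q₁
    p′q₁ = trans (opposite Pp′ Pp Q₁ Q₂ (p≢p′ ∘ sym) q₁≢q₂) pq₂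

    from-β : Dec (u ≡ p) → Dec (v ≡ q₁) → col u v ≡ col p q₁
    from-β (no u≢p)   (no v≢q₁)  = opposite Pu Pp Qv Q₁ u≢p v≢q₁
    from-β (no u≢p)   (yes refl) = trans (opposite Pu Pp Qv Q₂ u≢p q₁≢q₂) pq₂
    from-β (yes refl) (no v≢q₁)  = trans (opposite Pu Pp′ Qv Q₁ p≢p′ v≢q₁) p′q₁
    from-β (yes refl) (yes refl) = refl

  K₂₃ : ∀ {u u′ v₁ v₂ v₃} → u ≢ u′ → v₁ ≢ v₂ → v₁ ≢ v₃ → v₂ ≢ v₃ →
        (∀ {w v} → w ∈ u ∷ u′ ∷ [] → v ∈ v₁ ∷ v₂ ∷ v₃ ∷ [] → w ~ v) → col u v₁ ≡ col u v₂
  K₂₃ {u} {u′} {v₁} {v₂} {v₃} u≢u′ v₁≢v₂ v₁≢v₃ v₂≢v₃ edge =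
    sym (biclique (_∈ u ∷ u′ ∷ []) (_∈ v₁ ∷ v₂ ∷ v₃ ∷ []) edge 1st 2nd 1st 2nd 3rd
          u≢u′ v₁≢v₂ v₁≢v₃ v₂≢v₃ 1st 2nd)

  covers-at : ∀ x {L} → (∀ u v → u ≢ x → v ≢ x → u ~ v → col u v ∈ L) →
              (∀ z → x ~ z → col x z ∈ L) → Covers L
  covers-at x inner at-x u v uv with u ≟ x | v ≟ x
  ... | yes refl | _        = at-x v uv
  ... | no _     | yes refl = col-flip (at-x u (~-sym uv))
  ... | no u≢x   | no v≢x   = inner u v u≢x v≢x uv

  -- If at most one edge at x escapes the list L, one more color suffices.
  one-more : ∀ x L →
    (∀ u v → u ≢ x → v ≢ x → u ~ v → col u v ∈ L) →
    (∀ y z → y ≢ z → x ~ y → x ~ z → col x y ∈ L ⊎ col x z ∈ L) →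
    AtMost (suc (length L))
  one-more x L inner outer with any? (λ y → (x ~? y) ×-dec ¬? (col x y ∈? L))
  ... | no none = L , ℕ.n≤1+n _ ,
    covers-at x inner λ z xz → ∈-stable λ z∉ → none (z , xz , z∉)
  ... | yes (y , xy , y∉) = col x y ∷ L , ≤-refl ,
    covers-at x (λ u v u≢x v≢x uv → there (inner u v u≢x v≢x uv)) at-x
    where
    at-x : ∀ z → x ~ z → col x z ∈ col x y ∷ L
    at-x z xz with z ≟ y
    ... | yes refl = 1st
    ... | no z≢y with outer z y z≢y xz xy
    ...   | inj₁ z∈ = there z∈
    ...   | inj₂ y∈ = ⊥-elim (y∉ y∈)

  -- Vertices adjacent to at least two corners of a triangle share a corner.
  module Hub (t : Fin 3 → Fin n) (t~t : ∀ {j k} → j ≢ k → t j ~ t k) where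

    ρ : ℕ
    ρ = col (t zero) (t (suc zero))

    Near : Fin n → Set
    Near v = ∃[ k ] (∀ j → j ≢ k → v ~ t j)

    col-t : ∀ j k → j ≢ k → col (t j) (t k) ≡ ρ
    col-t zero zero p = ⊥-elim (p refl)
    col-t zero (suc zero) p = refl
    col-t zero (suc (suc zero)) p = sym (triangle′ (t~t λ ()) (t~t λ ()) (t~t p))
    col-t (suc zero) zero p = col-sym _ _
    col-t (suc zero) (suc zero) p = ⊥-elim (p refl)
    col-t (suc zero) (suc (suc zero)) p = sym (triangle (t~t λ ()) (t~t p) (t~t λ ()))
    col-t (suc (suc zero)) zero p = trans (col-sym _ _) (col-t zero (suc (suc zero)) (λ ()))
    col-t (suc (suc zero)) (suc zero) p = trans (col-sym _ _) (col-t (suc zero) (suc (suc zero)) (λ ()))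
    col-t (suc (suc zero)) (suc (suc zero)) p = ⊥-elim (p refl)

    col-near : ∀ {v} (N : Near v) → ∀ j → j ≢ proj₁ N → col v (t j) ≡ ρ
    col-near (k , near) j j≢k with third j k
    ... | l , l≢j , l≢k =
      trans (sym (triangle′ (near l l≢k) (t~t l≢j) (near j j≢k)) )
        (trans (triangle (near l l≢k) (t~t l≢j) (near j j≢k)) (col-t l j l≢j))

    common : ∀ {v w} → Near v → Near w →
             ∃[ j ] v ~ t j × w ~ t j × col v (t j) ≡ ρ × col w (t j) ≡ ρ
    common N@(k , v~) M@(l , w~) with third k l
    ... | j , j≢k , j≢l = j , v~ j j≢k , w~ j j≢l , col-near N j j≢k , col-near M j j≢l

    inner : ∀ {v w} → Near v → Near w → v ~ w → col v w ≡ ρ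
    inner N M vw with common N M
    ... | j , vt , wt , p , _ = trans (triangle′ vw wt vt) p

    -- A common corner t j of y and y′ closes the 4-cycle z y (t j) y′, in which z y is opposite to
    -- an edge of color ρ.
    outer : ∀ {z y y′} → (∀ j → z ≢ t j) → Near y → Near y′ → y ≢ y′ → z ~ y → z ~ y′ →
            col z y ≡ ρ
    outer z∉ N M y≢y′ zy zy′ with common N M
    ... | j , yt , y′t , _ , q =
      trans (square zy yt (~-sym y′t) (~-sym zy′) (z∉ j) y≢y′) (trans (col-sym _ _) q)

-- Colors occurring at a single vertex only

fresh : (xs : List (Fin n)) → length xs < n → ∃[ y ] y ∉ xs
fresh {n} xs xs<n with any? (λ y → y ∉? xs)
  where open DecMembership (_≟_ {n}) using (_∉?_)
... | yes p   = p
... | no none = ⊥-elim (ℕ.<⇒≱ xs<n (injective⇒≤ {f = index ∘ member} inj))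
  where
  open DecMembership (_≟_ {n}) using () renaming (_∈?_ to _∈ᶠ?_)
  member : ∀ y → y ∈ xs
  member y = decidable-stable (y ∈ᶠ? xs) λ y∉ → none (y , y∉)
  inj : ∀ {y z} → index (member y) ≡ index (member z) → y ≡ z
  inj {y} {z} p = trans (lookup-index (member y))
    (trans (cong (lookup xs) p) (sym (lookup-index (member z))))

triple : ∀ {A : Set} → A → A → A → Fin 3 → A
triple u v w zero             = u
triple u v w (suc zero)       = v
triple u v w (suc (suc zero)) = w

triple-all : ∀ {A : Set} {u v w : A} (P : A → Set) → P u → P v → P w → ∀ j → P (triple u v w j)
triple-all P Pu Pv Pw zero             = Pu
triple-all P Pu Pv Pw (suc zero)       = Pv
triple-all P Pu Pv Pw (suc (suc zero)) = Pw

triple-pairs : ∀ {A : Set} {u v w : A} (_#_ : A → A → Set) → (∀ {a b} → a # b → b # a) →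
               u # v → u # w → v # w →
               ∀ {j k} → j ≢ k → triple u v w j # triple u v w k
triple-pairs _ #-sym uv uw vw {zero}           {zero}           j≢k = ⊥-elim (j≢k refl)
triple-pairs _ #-sym uv uw vw {zero}           {suc zero}       _   = uv
triple-pairs _ #-sym uv uw vw {zero}           {suc (suc zero)} _   = uw
triple-pairs _ #-sym uv uw vw {suc zero}       {zero}           _   = #-sym uv
triple-pairs _ #-sym uv uw vw {suc zero}       {suc zero}       j≢k = ⊥-elim (j≢k refl)
triple-pairs _ #-sym uv uw vw {suc zero}       {suc (suc zero)} _   = vw
triple-pairs _ #-sym uv uw vw {suc (suc zero)} {zero}           _   = #-sym uw
triple-pairs _ #-sym uv uw vw {suc (suc zero)} {suc zero}       _   = #-sym vw
triple-pairs _ #-sym uv uw vw {suc (suc zero)} {suc (suc zero)} j≢k = ⊥-elim (j≢k refl)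

-- Allows a proof of ⊥ to assume that membership in a component is decided for all vertices at once.
¬¬-Π : {P : Fin n → Set} → (∀ i → ¬ ¬ P i) → ¬ ¬ (∀ i → P i)
¬¬-Π = sequence (RawMonad.rawApplicative ¬¬-Monad)

-- Complementary pairs of structures

record Complementary (R B : MDStructure n) : Set where
  private
    module R = MDStructure R
    module B = MDStructure B
  field
    total : ∀ {u v} → u ≢ v → u R.~ v ⊎ u B.~ v
    excl  : ∀ {u v} → u R.~ v → ¬ u B.~ v

  blue : ∀ {u v} → u ≢ v → ¬ u R.~ v → u B.~ v
  blue u≢v ¬uv with total u≢v
  ... | inj₁ uv = ⊥-elim (¬uv uv)
  ... | inj₂ uv = uv

  red : ∀ {u v} → u ≢ v → ¬ u B.~ v → u R.~ v
  red u≢v ¬uv with total u≢v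
  ... | inj₁ uv = uv
  ... | inj₂ uv = ⊥-elim (¬uv uv)

complementary-sym : {R B : MDStructure n} → Complementary R B → Complementary B R
complementary-sym c = record
  { total = λ u≢v → [ inj₂ , inj₁ ] (total u≢v) ; excl = λ b r → excl r b }
  where open Complementary c

Few : (R B : MDStructure n) → Set
Few R B = AtMost R 2 ⊎ AtMost B 2 ⊎ (AtMost R 3 × AtMost B 3)
  where open MDStructure

module _ {n : ℕ} (6≤n : 6 ≤ n) {R B : MDStructure n} (compl : Complementary R B)
         (many : ¬ Few R B) where
  private
    module R = MDStructure R
    module B = MDStructure B
  open Complementary compl

  not-R2 : ¬ R.AtMost 2
  not-R2 = many ∘ inj₁

  not-B2 : ¬ B.AtMost 2
  not-B2 = many ∘ inj₂ ∘ inj₁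

  not-33 : R.AtMost 3 → ¬ B.AtMost 3
  not-33 r b = many (inj₂ (inj₂ (r , b)))

  -- Excluding a vertex p with a single red neighbor q

  module _ {p q : Fin n} (pq : p R.~ q)
           (p-blue : ∀ {w} → w ≢ p → w ≢ q → p B.~ w) where
    private
      -- W is the set of blue neighbors of p. The colors of the blue edges at p partition it into
      -- classes.
      record InW (w : Fin n) : Set where
        constructor _&_
        field
          ≢p : w ≢ p
          ≢q : w ≢ q
      open InW

      p~ : ∀ {w} → InW w → p B.~ w
      p~ (w≢p & w≢q) = p-blue w≢p w≢q

      p-red : ∀ {w} → p R.~ w → w ≡ q
      p-red {w} pw = decidable-stable (w ≟ q) λ w≢q →
        excl pw (p-blue (≢-sym (R.~⇒≢ pw)) w≢q)

      -- A blue edge v w would close a blue triangle with p. Hence distinct classes of W are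
      -- completely joined in red.
      red-between : ∀ {v w} → InW v → InW w → B.col p v ≢ B.col p w → v R.~ w
      red-between v∈ w∈ ≢κ = red (λ { refl → ≢κ refl }) λ vw → ≢κ (B.triangle′ (p~ v∈) vw (p~ w∈))

      q-nbr : ∀ {w} → q B.~ w → InW w
      q-nbr qw = (λ { refl → excl pq (B.~-sym qw) }) & ≢-sym (B.~⇒≢ qw)

      -- In the blue 4-cycle p v q w the edge q v is opposite to p w, not to p v.
      q-blue² : ∀ {v w} → v ≢ w → q B.~ v → q B.~ w → B.col q v ≡ B.col p w
      q-blue² v≢w qv qw = trans (B.col-sym _ _) (trans
        (B.square (B.~-sym qv) qw (B.~-sym (p~ (q-nbr qw))) (p~ (q-nbr qv)) v≢w (≢-sym (R.~⇒≢ pq)))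
        (B.col-sym _ _))

      red-off-q : ∀ {u v} → u ≢ q → v ≢ q → u R.~ v → InW u × InW v
      red-off-q u≢q v≢q uv =
        (λ { refl → v≢q (p-red uv) }) & u≢q , (λ { refl → u≢q (p-red (R.~-sym uv)) }) & v≢q

      red-q : ∀ {w} → q R.~ w → w ≢ p → InW w
      red-q qw w≢p = w≢p & ≢-sym (R.~⇒≢ qw)

      no-K₂₃ : ∀ {v₁ v₂ v₃} → InW v₁ → InW v₂ → InW v₃ → v₁ ≢ v₃ → v₂ ≢ v₃ →
               q B.~ v₁ → q B.~ v₂ → q B.~ v₃ → B.col p v₁ ≢ B.col p v₂ → ⊥
      no-K₂₃ i₁ i₂ i₃ v₁≢v₃ v₂≢v₃ e₁ e₂ e₃ ≢κ =
        ≢κ (B.K₂₃ (R.~⇒≢ pq) (λ { refl → ≢κ refl }) v₁≢v₃ v₂≢v₃ λ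
          { 1st 1st → p~ i₁ ; 1st 2nd → p~ i₂ ; 1st 3rd → p~ i₃
          ; 2nd 1st → e₁ ; 2nd 2nd → e₂ ; 2nd 3rd → e₃ })

      -- Representatives of three classes form a red triangle, and a vertex of W misses at most the
      -- corner of its own class, so all red edges inside W have color ρ. Two red edges from q to W
      -- would extend ρ to all such edges, leaving two red colors. So q is blue to all of W but at
      -- most one vertex, and p, q span a blue K₂,₃ with vertices from different classes.
      module ThreeColors (t : Fin 3 → Fin n) (t∈ : ∀ j → InW (t j))
        (distinct : ∀ {j k} → j ≢ k → B.col p (t j) ≢ B.col p (t k)) where

        t-injective : ∀ {j k} → j ≢ k → t j ≢ t k
        t-injective j≢k e = distinct j≢k (cong (B.col p) e)

        open R.Hub t (λ {j} {k} j≢k → red-between (t∈ j) (t∈ k) (distinct j≢k))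

        near : ∀ {w} → InW w → Near w
        near {w} w∈ with any? (λ k → B.col p w ℕ.≟ B.col p (t k))
        ... | yes (k , e) = k , λ j j≢k → red-between w∈ (t∈ j) λ e′ → distinct j≢k (trans (sym e′) e)
        ... | no none     = zero , λ j _ → red-between w∈ (t∈ j) λ e → none (j , e)

        L : List ℕ
        L = ρ ∷ R.col q p ∷ []

        off-q : ∀ u v → u ≢ q → v ≢ q → u R.~ v → R.col u v ∈ L
        off-q u v u≢q v≢q uv with red-off-q u≢q v≢q uv
        ... | u∈ , v∈ = here (inner (near u∈) (near v∈) uv)

        two-red : ∀ {y z} → InW y → InW z → y ≢ z → q R.~ y → q R.~ z → ⊥
        two-red {y} {z} y∈ z∈ y≢z qy qz =
          not-R2 (L , ≤-refl , R.covers-at q off-q at-q)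
          where
          ρ-by : ∀ {v w} → InW v → InW w → v ≢ w → q R.~ v → q R.~ w → R.col q v ∈ L
          ρ-by v∈ w∈ v≢w qv qw =
            here (outer (λ j → ≢-sym (InW.≢q (t∈ j))) (near v∈) (near w∈) v≢w qv qw)
          at-q : ∀ w → q R.~ w → R.col q w ∈ L
          at-q w qw with w ≟ p | w ≟ y
          ... | yes refl | _        = 2nd
          ... | no w≢p   | no w≢y   = ρ-by (red-q qw w≢p) y∈ w≢y qw qy
          ... | no _     | yes refl = ρ-by y∈ z∈ y≢z qy qz

        blue-except : ∀ {w w′} → InW w → InW w′ → w ≢ w′ → q R.~ w → q B.~ w′
        blue-except w∈ w′∈ w≢w′ qw = blue (≢-sym (InW.≢q w′∈)) (two-red w∈ w′∈ w≢w′ qw)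

        absurd : ⊥
        absurd with any? (λ k → q R.~? t k)
        ... | no none = no-K₂₃ (t∈ zero) (t∈ (suc zero)) (t∈ (suc (suc zero)))
                          (t-injective (λ ())) (t-injective (λ ()))
                          (qt zero) (qt (suc zero)) (qt (suc (suc zero))) (distinct λ ())
          where
          qt : ∀ k → q B.~ t k
          qt k = blue (≢-sym (InW.≢q (t∈ k))) λ e → none (k , e)
        -- The corner t k is lost to a red edge; a sixth vertex replaces it as the third vertex of
        -- the K₂,₃.
        ... | yes (k , qt) with others k | fresh (p ∷ q ∷ tabulate t) 6≤n
          where
          others : (k : Fin 3) → ∃[ i ] ∃[ j ] k ≢ i × k ≢ j × i ≢ j
          others = from-yes (all? {n = 3} λ k → any? {n = 3} λ i → any? {n = 3} λ j →
            ¬? (k ≟ i) ×-dec ¬? (k ≟ j) ×-dec ¬? (i ≟ j))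
        ...   | i , j , k≢i , k≢j , i≢j | y , y∉ =
          no-K₂₃ (t∈ i) (t∈ j) y∈ (≢-sym (y≢t i)) (≢-sym (y≢t j))
            (blue-except (t∈ k) (t∈ i) (t-injective k≢i) qt)
            (blue-except (t∈ k) (t∈ j) (t-injective k≢j) qt)
            (blue-except (t∈ k) y∈ (≢-sym (y≢t k)) qt) (distinct i≢j)
          where
          y∈ : InW y
          y∈ = (λ { refl → y∉ 1st }) & (λ { refl → y∉ 2nd })
          y≢t : ∀ j → y ≢ t j
          y≢t j refl = y∉ (there (there (∈-tabulate⁺ {f = t} j)))

      three-colors : ∀ {u v w} → InW u → InW v → InW w → B.col p u ≢ B.col p v →
                     B.col p u ≢ B.col p w → B.col p v ≢ B.col p w → ⊥
      three-colors {u} {v} {w} u∈ v∈ w∈ u≢v u≢w v≢w =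
        ThreeColors.absurd (triple u v w) (triple-all InW u∈ v∈ w∈)
          (triple-pairs (λ a b → B.col p a ≢ B.col p b) ≢-sym u≢v u≢w v≢w)

      blue-off-q : ∀ {L} → (∀ w → InW w → B.col p w ∈ L) →
                   ∀ u v → u ≢ q → v ≢ q → u B.~ v → B.col u v ∈ L
      blue-off-q {L} cover u v u≢q v≢q uv with u ≟ p | v ≟ p
      ... | yes refl | _        = cover v (≢-sym (B.~⇒≢ uv) & v≢q)
      ... | no u≢p   | yes refl = B.col-flip (cover u (u≢p & u≢q))
      ... | no u≢p   | no v≢p   = subst (_∈ L)
        (B.triangle (p~ (u≢p & u≢q)) uv (p~ (v≢p & v≢q))) (cover u (u≢p & u≢q))

      -- A color of q w₁ foreign to p makes q w₁ the only blue edge at q.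
      module Foreign {κ₁ κ₂} (cover : ∀ w → InW w → B.col p w ∈ κ₁ ∷ κ₂ ∷ [])
        {w₁} (qw₁ : q B.~ w₁) (foreign : B.col q w₁ ∉ κ₁ ∷ κ₂ ∷ []) where

        w₁∈ : InW w₁
        w₁∈ = q-nbr qw₁

        q-red : ∀ {w} → InW w → w ≢ w₁ → q R.~ w
        q-red w∈ w≢w₁ = red (≢-sym (InW.≢q w∈)) λ qw →
          foreign (subst (_∈ _) (sym (q-blue² (≢-sym w≢w₁) qw₁ qw)) (cover _ w∈))

        q-red⁻ : ∀ {w} → q R.~ w → w ≢ w₁
        q-red⁻ qw refl = excl qw qw₁

        monochrome : ¬ (∀ w → InW w → B.col p w ≡ B.col p w₁)
        monochrome same = not-B2 (B.col p w₁ ∷ B.col q w₁ ∷ [] , ≤-refl ,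
          B.covers-at q (blue-off-q λ w w∈ → here (same w w∈)) at-q)
          where
          at-q : ∀ w → q B.~ w → B.col q w ∈ B.col p w₁ ∷ B.col q w₁ ∷ []
          at-q w qw with w ≟ w₁
          ... | yes refl = 2nd
          ... | no w≢w₁  = here (q-blue² w≢w₁ qw qw₁)

        module _ {y} (y∈ : InW y) (y≢κ : B.col p y ≢ B.col p w₁) where

          y≢w₁ : y ≢ w₁
          y≢w₁ refl = y≢κ refl

          qy : q R.~ y
          qy = q-red y∈ y≢w₁

          w₁y : w₁ R.~ y
          w₁y = red-between w₁∈ y∈ (≢-sym y≢κ)

          ρ : ℕ
          ρ = R.col q y

          -- The red triangle q z y, together with triangles through y or z, gives color ρ to all
          -- red edges from q to W. Triangles with q spread ρ over W without w₁, and triangles or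
          -- 4-cycles through y carry it to w₁. Only q p and w₁ y may differ.
          class-shared : ∀ {z} → InW z → z ≢ w₁ → B.col p z ≡ B.col p w₁ → R.AtMost 3
          class-shared {z} z∈ z≢w₁ z≡κ = L , ≤-refl , R.covers-at q off-q at-q
            where
            L : List ℕ
            L = R.col q p ∷ ρ ∷ R.col w₁ y ∷ []

            qz : q R.~ z
            qz = q-red z∈ z≢w₁

            zy : z R.~ y
            zy = red-between z∈ y∈ λ e → y≢κ (trans (sym e) z≡κ)

            q-ρ : ∀ {w} → InW w → w ≢ w₁ → R.col q w ≡ ρ
            q-ρ {w} w∈ w≢w₁ with B.col p w ℕ.≟ B.col p w₁
            ... | yes e = R.triangle′ (q-red w∈ w≢w₁)
                            (red-between w∈ y∈ λ e′ → y≢κ (trans (sym e′) e)) qy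
            ... | no ≢κ = trans
              (R.triangle′ (q-red w∈ w≢w₁) (red-between w∈ z∈ λ e → ≢κ (trans e z≡κ)) qz)
              (R.triangle′ qz zy qy)

            off-w₁ : ∀ {u v} → InW u → InW v → u ≢ w₁ → v ≢ w₁ → u R.~ v → R.col u v ≡ ρ
            off-w₁ u∈ v∈ u≢w₁ v≢w₁ uv =
              trans (sym (R.triangle (q-red u∈ u≢w₁) uv (q-red v∈ v≢w₁))) (q-ρ u∈ u≢w₁)

            at-w₁ : ∀ v → InW v → v ≢ w₁ → w₁ R.~ v → R.col w₁ v ∈ L
            at-w₁ v v∈ v≢w₁ w₁v with v ≟ y | B.col p v ℕ.≟ B.col p w₁
            ... | yes refl | _     = 3rd
            ... | no v≢y   | yes e = there (here (trans (R.triangle w₁v vy w₁y)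
                                       (off-w₁ v∈ y∈ v≢w₁ y≢w₁ vy)))
              where
              vy : v R.~ y
              vy = red-between v∈ y∈ λ e′ → y≢κ (trans (sym e′) e)
            ... | no v≢y   | no _  = there (here
              (R.square w₁v (R.~-sym (q-red v∈ v≢w₁)) qy (R.~-sym w₁y) (InW.≢q w₁∈) v≢y))

            off-q : ∀ u v → u ≢ q → v ≢ q → u R.~ v → R.col u v ∈ L
            off-q u v u≢q v≢q uv with red-off-q u≢q v≢q uv | u ≟ w₁ | v ≟ w₁
            ... | _ , v∈  | yes refl | _        = at-w₁ v v∈ (≢-sym (R.~⇒≢ uv)) uv
            ... | u∈ , _  | no u≢w₁  | yes refl = R.col-flip (at-w₁ u u∈ u≢w₁ (R.~-sym uv))
            ... | u∈ , v∈ | no u≢w₁  | no v≢w₁  = there (here (off-w₁ u∈ v∈ u≢w₁ v≢w₁ uv))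

            at-q : ∀ w → q R.~ w → R.col q w ∈ L
            at-q w qw with w ≟ p
            ... | yes refl = 1st
            ... | no w≢p   = there (here (q-ρ (red-q qw w≢p) (q-red⁻ qw)))

          -- Now q and w₁ are both red to every other vertex of W. As n ≥ 6, there are at least
          -- three of these, so `R.biclique` yields a single color.
          class-alone : ¬ (∀ z → InW z → z ≢ w₁ → B.col p z ≢ B.col p w₁)
          class-alone alone = not-R2 (L , ≤-refl , R.covers-at q off-q at-q)
            where
            L : List ℕ
            L = R.col q p ∷ ρ ∷ []

            Other : Fin n → Set
            Other w = InW w × w ≢ w₁

            joined : ∀ {u v} → u ∈ q ∷ w₁ ∷ [] → Other v → u R.~ v
            joined 1st (v∈ , v≢w₁) = q-red v∈ v≢w₁
            joined 2nd (v∈ , v≢w₁) = red-between w₁∈ v∈ (≢-sym (alone _ v∈ v≢w₁))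

            f₁ = fresh (p ∷ q ∷ w₁ ∷ y ∷ []) (≤-trans (ℕ.n≤1+n _) 6≤n)
            f₂ = fresh (p ∷ q ∷ w₁ ∷ y ∷ proj₁ f₁ ∷ []) 6≤n

            other : ∀ {v L} → v ∉ p ∷ q ∷ w₁ ∷ L → Other v
            other v∉ = ((λ { refl → v∉ 1st }) & (λ { refl → v∉ 2nd })) , λ { refl → v∉ 3rd }

            all-ρ : ∀ {u v} → u ∈ q ∷ w₁ ∷ [] → Other v → R.col u v ≡ ρ
            all-ρ = R.biclique (_∈ q ∷ w₁ ∷ []) Other joined 1st 2nd (y∈ , y≢w₁)
              (other (proj₂ f₁)) (other (proj₂ f₂)) (≢-sym (InW.≢q w₁∈))
              (λ e → proj₂ f₁ (there (there (there (here (sym e))))))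
              (λ e → proj₂ f₂ (there (there (there (here (sym e))))))
              (λ e → proj₂ f₂ (there (there (there (there (here (sym e)))))))

            off-q : ∀ u v → u ≢ q → v ≢ q → u R.~ v → R.col u v ∈ L
            off-q u v u≢q v≢q uv with red-off-q u≢q v≢q uv | u ≟ w₁ | v ≟ w₁
            ... | _ , v∈  | yes refl | _        = there (here (all-ρ 2nd (v∈ , ≢-sym (R.~⇒≢ uv))))
            ... | u∈ , _  | no u≢w₁  | yes refl =
              R.col-flip (there (here (all-ρ 2nd (u∈ , u≢w₁))))
            ... | u∈ , v∈ | no u≢w₁  | no v≢w₁  = there (here
              (trans (sym (R.triangle (q-red u∈ u≢w₁) uv (q-red v∈ v≢w₁))) (all-ρ 1st (u∈ , u≢w₁))))

            at-q : ∀ w → q R.~ w → R.col q w ∈ L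
            at-q w qw with w ≟ p
            ... | yes refl = 1st
            ... | no w≢p   = there (here (all-ρ 1st (red-q qw w≢p , q-red⁻ qw)))

      -- Blue edges inside W repeat a color at p, so a third blue color can only appear on an edge q
      -- w₁. That edge adds just one color, so blue has at most three, and it suffices to find at
      -- most three red ones. κ₁ = κ₂ is allowed.
      two-colors : ∀ κ₁ κ₂ → ¬ (∀ w → InW w → B.col p w ∈ κ₁ ∷ κ₂ ∷ [])
      two-colors κ₁ κ₂ cover with any? (λ w → (q B.~? w) ×-dec ¬? (B.col q w ∈? κ₁ ∷ κ₂ ∷ []))
      ... | no none = not-B2 (κ₁ ∷ κ₂ ∷ [] , ≤-refl , B.covers-at q (blue-off-q cover)
              λ w qw → ∈-stable λ w∉ → none (w , qw , w∉))
      ... | yes (w₁ , qw₁ , foreign) = ¬¬-excluded-middle {A = ∃[ y ] InW y × B.col p y ≢ B.col p w₁} λ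
        { (no none) → F.monochrome λ w w∈ → decidable-stable (_ ℕ.≟ _) λ ≢κ → none (w , w∈ , ≢κ)
        ; (yes (y , y∈ , y≢κ)) → ¬¬-excluded-middle
            {A = ∃[ z ] InW z × z ≢ w₁ × B.col p z ≡ B.col p w₁} λ
          { (yes (z , z∈ , z≢w₁ , z≡κ)) → not-33 (F.class-shared y∈ y≢κ z∈ z≢w₁ z≡κ) B₃
          ; (no none) → F.class-alone y∈ y≢κ λ z z∈ z≢w₁ z≡κ → none (z , z∈ , z≢w₁ , z≡κ) } }
        where
        module F = Foreign cover qw₁ foreign
        B₃ : B.AtMost 3
        B₃ = B.one-more q (κ₁ ∷ κ₂ ∷ []) (blue-off-q cover) λ y z y≢z qy qz →
          inj₁ (subst (_∈ _) (sym (q-blue² y≢z qy qz)) (cover z (q-nbr qz)))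

    -- The blue edges at p carry one, two or at least three colors; each case has been excluded.
    no-pendant : ⊥
    no-pendant with fresh (p ∷ q ∷ []) (≤-trans (s≤s (s≤s (s≤s z≤n))) 6≤n)
    ... | w₀ , w₀∉ = ¬¬-excluded-middle {A = ∃[ v ] InW v × B.col p v ≢ κ₁} λ
      { (no none) → two-colors κ₁ κ₁ λ w w∈ → ∈-stable λ w∉ → none (w , w∈ , w∉ ∘ here)
      ; (yes (v , v∈ , v≢κ₁)) → two-colors κ₁ (B.col p v) λ w w∈ → ∈-stable λ w∉ →
          three-colors w₀∈ v∈ w∈ (≢-sym v≢κ₁) (w∉ ∘ here ∘ sym) (w∉ ∘ there ∘ here ∘ sym) }
      where
      κ₁ = B.col p w₀
      w₀∈ : InW w₀
      w₀∈ = (λ { refl → w₀∉ 1st }) & (λ { refl → w₀∉ 2nd })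

  -- A red color i occurring only at the vertex x

  module Critical {x a} (xa : x R.~ a)
    (crit : ∀ u v → u ≢ x → v ≢ x → u R.~ v → R.col u v ≢ R.col x a) where
    private
      i : ℕ
      i = R.col x a

      x≢ : ∀ {v} → x R.~ v → v ≢ x
      x≢ xv = ≢-sym (R.~⇒≢ xv)

      module AllCritical (all-i : ∀ y → x R.~ y → R.col x y ≡ i) where

        nbrs-blue : ∀ {b c} → x R.~ b → x R.~ c → b ≢ c → b B.~ c
        nbrs-blue {b} {c} xb xc b≢c = blue b≢c λ bc →
          crit b c (x≢ xb) (x≢ xc) bc (trans (sym (R.triangle xb bc xc)) (all-i b xb))

        -- In the red 4-cycle x b v c the edge v c is opposite to x b and would carry i away from x.
        no-common : ∀ {b c v} → x R.~ b → x R.~ c → b ≢ c → v ≢ x → v R.~ b → ¬ v R.~ c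
        no-common {b} {c} {v} xb xc b≢c v≢x vb vc = crit v c v≢x (x≢ xc) vc
          (trans (sym (R.square xb (R.~-sym vb) vc (R.~-sym xc) (≢-sym v≢x) b≢c)) (all-i b xb))

        -- Three red neighbors of x form a blue triangle, and by `no-common` every vertex except x
        -- is blue to at least two of its corners. So ρ is the only blue color, up to a possible
        -- lone blue edge at x.
        three-nbrs : (t : Fin 3 → Fin n) → (∀ j → x R.~ t j) → (∀ {j k} → j ≢ k → t j ≢ t k) → ⊥
        three-nbrs t xt t-injective = not-B2 (B.one-more x (ρ ∷ [])
          (λ u v u≢x v≢x uv → here (inner (near u≢x) (near v≢x) uv))
          (λ y z y≢z xy xz → inj₁ (here
            (outer (λ j → R.~⇒≢ (xt j)) (near (≢-sym (B.~⇒≢ xy))) (near (≢-sym (B.~⇒≢ xz)))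
              y≢z xy xz))))
          where
          t~t : ∀ {j k} → j ≢ k → t j B.~ t k
          t~t j≢k = nbrs-blue (xt _) (xt _) (t-injective j≢k)

          open B.Hub t t~t

          near : ∀ {v} → v ≢ x → Near v
          near {v} v≢x with any? (λ k → ¬? (v B.~? t k))
          ... | no none = zero , λ j _ → decidable-stable (v B.~? t j) λ ¬e → none (j , ¬e)
          ... | yes (k , ¬vt) = k , others
            where
            others : ∀ j → j ≢ k → v B.~ t j
            others j j≢k with v ≟ t k
            ... | yes refl = t~t (≢-sym j≢k)
            ... | no v≢t = blue (λ { refl → excl (red v≢t ¬vt) (t~t j≢k) })
                             (no-common (xt k) (xt j) (t-injective (≢-sym j≢k)) v≢x (red v≢t ¬vt))

        module TwoNbrs {b} (xb : x R.~ b) (a≢b : a ≢ b)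
          (only : ∀ {y} → x R.~ y → y ≢ a → y ≡ b) where

          record InW (w : Fin n) : Set where
            constructor ⟨_,_,_⟩
            field
              ≢x : w ≢ x
              ≢a : w ≢ a
              ≢b : w ≢ b
          open InW

          ab : a B.~ b
          ab = nbrs-blue xa xb a≢b

          x~ : ∀ {w} → InW w → x B.~ w
          x~ w∈ = blue (≢-sym (≢x w∈)) λ xw → ≢b w∈ (only xw (≢a w∈))

          x-nbr : ∀ {w} → x B.~ w → InW w
          x-nbr xw = ⟨ ≢-sym (B.~⇒≢ xw) , (λ { refl → excl xa xw }) , (λ { refl → excl xb xw }) ⟩

          either : ∀ {w} → InW w → a B.~ w ⊎ b B.~ w
          either {w} w∈ with a B.~? w
          ... | yes aw = inj₁ aw
          ... | no ¬aw = inj₂ (blue (≢-sym (≢b w∈)) λ bw →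
            no-common xa xb a≢b (≢x w∈) (R.~-sym (red (≢-sym (≢a w∈)) ¬aw)) (R.~-sym bw))

          module _ {L} (ab∈ : B.col a b ∈ L) (x∈ : ∀ {w} → InW w → B.col x w ∈ L)
            (a∈ : ∀ {w} → InW w → a B.~ w → B.col a w ∈ L)
            (b∈ : ∀ {w} → InW w → b B.~ w → B.col b w ∈ L) where

            at-a : ∀ v → v ≢ x → a B.~ v → B.col a v ∈ L
            at-a v v≢x av with v ≟ b
            ... | yes refl = ab∈
            ... | no v≢b   = a∈ ⟨ v≢x , ≢-sym (B.~⇒≢ av) , v≢b ⟩ av

            at-b : ∀ v → v ≢ x → b B.~ v → B.col b v ∈ L
            at-b v v≢x bv with v ≟ a
            ... | yes refl = B.col-flip ab∈
            ... | no v≢a   = b∈ ⟨ v≢x , v≢a , ≢-sym (B.~⇒≢ bv) ⟩ bv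

            cover : B.Covers L
            cover = B.covers-at x off-x λ w xw → x∈ (x-nbr xw)
              where
              off-x : ∀ u v → u ≢ x → v ≢ x → u B.~ v → B.col u v ∈ L
              off-x u v u≢x v≢x uv with u ≟ a | v ≟ a | u ≟ b | v ≟ b
              ... | yes refl | _ | _ | _ = at-a v v≢x uv
              ... | no _ | yes refl | _ | _ = B.col-flip (at-a u u≢x (B.~-sym uv))
              ... | no _ | no _ | yes refl | _ = at-b v v≢x uv
              ... | no _ | no _ | no _ | yes refl = B.col-flip (at-b u u≢x (B.~-sym uv))
              ... | no u≢a | no v≢a | no u≢b | no v≢b =
                let u∈ = ⟨ u≢x , u≢a , u≢b ⟩
                in subst (_∈ L) (B.triangle (x~ u∈) uv (x~ ⟨ v≢x , v≢a , v≢b ⟩)) (x∈ u∈)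

          -- Common neighbors w, w′ of x and c close up to the 4-cycle x w c w′.
          spread : ∀ {L c w′} → x ≢ c → InW w′ → c B.~ w′ → B.col x w′ ∈ L → B.col c w′ ∈ L →
                   ∀ {w} → InW w → c B.~ w → B.col x w ∈ L × B.col c w ∈ L
          spread {L} {c} {w′} x≢c w′∈ cw′ x∈ c∈ {w} w∈ cw with w ≟ w′
          ... | yes refl = x∈ , c∈
          ... | no w≢w′  =
            subst (_∈ L) (sym (B.square (x~ w∈) (B.~-sym cw) cw′ (B.~-sym (x~ w′∈)) x≢c w≢w′)) c∈ ,
            subst (_∈ L) (sym (B.square cw (B.~-sym (x~ w∈)) (x~ w′∈) (B.~-sym cw′) (≢-sym x≢c) w≢w′)) x∈

          -- The closed walk x v a b w has at most two colors, also when v = w. The 4-cycles formed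
          -- by x, by a or b, and by two common neighbors carry them to all blue edges between W and
          -- x, a, b.
          both-sides : ∀ {v w} → InW v → a B.~ v → InW w → b B.~ w → ⊥
          both-sides {v} {w} v∈ av w∈ bw
            with B.pentagon (x~ v∈) (B.~-sym av) ab bw (B.~-sym (x~ w∈))
          ... | p , q , xv∈ , va∈ , ab∈ , bw∈ , wx∈ = not-B2 (p ∷ q ∷ [] , ≤-refl ,
            cover ab∈ (λ u∈ → [ proj₁ ∘ via-a u∈ , proj₁ ∘ via-b u∈ ] (either u∈))
              (λ u∈ → proj₂ ∘ via-a u∈) (λ u∈ → proj₂ ∘ via-b u∈))
            where
            via-a = spread (R.~⇒≢ xa) v∈ av xv∈ (B.col-flip va∈)
            via-b = spread (R.~⇒≢ xb) w∈ bw (B.col-flip wx∈) bw∈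

          -- W misses only x, a, b, so n ≥ 6 gives it three vertices, and x, c are blue to all of
          -- them.
          one-side : ∀ {c} → x ≢ c → (∀ {w} → InW w → c B.~ w) →
                     ∃[ λ′ ] (∀ {w} → InW w → B.col x w ≡ λ′ × B.col c w ≡ λ′)
          one-side {c} x≢c c~ = B.col x (proj₁ f₁) , λ w∈ → same 1st w∈ , same 2nd w∈
            where
            f₁ = fresh (x ∷ a ∷ b ∷ []) (≤-trans (ℕ.m≤n+m 4 2) 6≤n)
            f₂ = fresh (x ∷ a ∷ b ∷ proj₁ f₁ ∷ []) (≤-trans (ℕ.n≤1+n 5) 6≤n)
            f₃ = fresh (x ∷ a ∷ b ∷ proj₁ f₁ ∷ proj₁ f₂ ∷ []) 6≤n

            inW : ∀ {w L} → w ∉ x ∷ a ∷ b ∷ L → InW w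
            inW w∉ = ⟨ (λ { refl → w∉ 1st }) , (λ { refl → w∉ 2nd }) , (λ { refl → w∉ 3rd }) ⟩

            joined : ∀ {u w} → u ∈ x ∷ c ∷ [] → InW w → u B.~ w
            joined 1st = x~
            joined 2nd = c~

            same : ∀ {u w} → u ∈ x ∷ c ∷ [] → InW w → B.col u w ≡ B.col x (proj₁ f₁)
            same = B.biclique (_∈ x ∷ c ∷ []) InW joined 1st 2nd
              (inW (proj₂ f₁)) (inW (proj₂ f₂)) (inW (proj₂ f₃)) x≢c
              (λ e → proj₂ f₂ (there (there (there (here (sym e))))))
              (λ e → proj₂ f₃ (there (there (there (here (sym e))))))
              (λ e → proj₂ f₃ (there (there (there (there (here (sym e)))))))

          only-b : ¬ (∀ {w} → InW w → ¬ a B.~ w)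
          only-b ¬a~ = not-B2 (B.col a b ∷ proj₁ side ∷ [] , ≤-refl ,
            cover 1st (λ w∈ → there (here (proj₁ (proj₂ side w∈)))) (λ w∈ aw → ⊥-elim (¬a~ w∈ aw))
              (λ w∈ _ → there (here (proj₂ (proj₂ side w∈)))))
            where
            side = one-side (R.~⇒≢ xb) λ w∈ → [ ⊥-elim ∘ ¬a~ w∈ , (λ bw → bw) ] (either w∈)

          only-a : ¬ (∀ {w} → InW w → ¬ b B.~ w)
          only-a ¬b~ = not-B2 (B.col a b ∷ proj₁ side ∷ [] , ≤-refl ,
            cover 1st (λ w∈ → there (here (proj₁ (proj₂ side w∈))))
              (λ w∈ _ → there (here (proj₂ (proj₂ side w∈)))) (λ w∈ bw → ⊥-elim (¬b~ w∈ bw)))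
            where
            side = one-side (R.~⇒≢ xa) λ w∈ → [ (λ aw → aw) , ⊥-elim ∘ ¬b~ w∈ ] (either w∈)

          two-nbrs : ⊥
          two-nbrs = only-b λ v∈ av → only-a λ w∈ bw → both-sides v∈ av w∈ bw

        all-critical : ⊥
        all-critical with any? (λ b → (x R.~? b) ×-dec ¬? (b ≟ a))
        ... | no none = no-pendant xa λ {w} w≢x w≢a →
          blue (≢-sym w≢x) λ xw → none (w , xw , w≢a)
        ... | yes (b , xb , b≢a) with any? (λ c → (x R.~? c) ×-dec ¬? (c ≟ a) ×-dec ¬? (c ≟ b))
        ...   | no none = TwoNbrs.two-nbrs xb (≢-sym b≢a) λ {y} xy y≢a →
          decidable-stable (y ≟ b) λ y≢b → none (y , xy , y≢a , y≢b)
        ...   | yes (c , xc , c≢a , c≢b) = three-nbrs (triple a b c)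
          (triple-all (x R.~_) xa xb xc) (triple-pairs _≢_ ≢-sym (≢-sym b≢a) (≢-sym c≢a) (≢-sym c≢b))

      module Mixed {m} (xm : x R.~ m) (xm≢i : R.col x m ≢ i) where

        A : Fin n → Set
        A v = i R.⊢ x ≈ v

        Am : A m
        Am = R.≈-edge xm xm≢i

        ¬Aa : ¬ A a
        ¬Aa = R.edge-sep xa

        x∉ : ∀ {v} → ¬ A v → v ≢ x
        x∉ ¬Av refl = ¬Av R.≈-refl

        -- A red pair leaving A must have color i, but i occurs only at x.
        blue-across : ∀ {u v} → A u → u ≢ x → ¬ A v → u B.~ v
        blue-across Au u≢x ¬Av = blue (λ { refl → ¬Av Au }) λ uv →
          ¬Av (R.≈-trans Au (R.≈-edge uv (crit _ _ u≢x (x∉ ¬Av) uv)))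

        module Both (A? : ∀ v → Dec (A v)) {m′ b} (Am′ : A m′) (m′≢x : m′ ≢ x) (m′≢m : m′ ≢ m)
          (¬Ab : ¬ A b) (b≢a : b ≢ a) where

          β : ℕ
          β = B.col m a

          A⁻ : Fin n → Set
          A⁻ v = A v × v ≢ x

          across : ∀ {u v} → A⁻ u → ¬ A v → u B.~ v
          across (Au , u≢x) = blue-across Au u≢x

          all-β : ∀ {u v} → A⁻ u → ¬ A v → B.col u v ≡ β
          -- Both sides already have two vertices besides x. Wherever the sixth one lies, one side
          -- of the blue biclique has three.
          all-β Au ¬Av with fresh (x ∷ m ∷ m′ ∷ a ∷ b ∷ []) 6≤n
          ... | y , y∉ with A? y
          ...   | yes Ay = trans (B.col-sym _ _) (trans
            (B.biclique (¬_ ∘ A) A⁻ (λ ¬Av Au → B.~-sym (across Au ¬Av)) ¬Aa ¬Ab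
              (Am , x≢ xm) (Am′ , m′≢x) (Ay , λ e → y∉ (here e)) (≢-sym b≢a) (≢-sym m′≢m)
              (λ e → y∉ (there (here (sym e)))) (λ e → y∉ (there (there (here (sym e))))) ¬Av Au)
            (B.col-sym _ _))
          ...   | no ¬Ay = B.biclique A⁻ (¬_ ∘ A) across (Am , x≢ xm) (Am′ , m′≢x) ¬Aa ¬Ab ¬Ay
              (≢-sym m′≢m) (≢-sym b≢a) (λ e → y∉ (there (there (there (here (sym e))))))
              (λ e → y∉ (there (there (there (there (here (sym e))))))) Au ¬Av

          am : A⁻ m
          am = Am , x≢ xm

          off-x : ∀ u v → u ≢ x → v ≢ x → u B.~ v → B.col u v ≡ β
          off-x u v u≢x v≢x uv with A? u | A? v
          ... | yes Au | no ¬Av = all-β (Au , u≢x) ¬Av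
          ... | no ¬Au | yes Av = trans (B.col-sym u v) (all-β (Av , v≢x) ¬Au)
          ... | yes Au | yes Av = trans
            (B.triangle′ uv (across (Av , v≢x) ¬Aa) (across (Au , u≢x) ¬Aa)) (all-β (Au , u≢x) ¬Aa)
          ... | no ¬Au | no ¬Av = trans
            (sym (B.triangle (across am ¬Au) uv (across am ¬Av))) (all-β am ¬Au)

          -- If A separates y from z, they close a blue triangle with x. Otherwise a or m, lying on
          -- the opposite side, completes a blue 4-cycle.
          at-x : ∀ y z → y ≢ z → x B.~ y → x B.~ z → B.col x y ≡ β
          at-x y z y≢z xy xz = go (A? y) (A? z)
            where
            y≢x = ≢-sym (B.~⇒≢ xy)
            z≢x = ≢-sym (B.~⇒≢ xz)
            go : Dec (A y) → Dec (A z) → B.col x y ≡ β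
            go (yes Ay) (no ¬Az) = trans (B.triangle xy (across (Ay , y≢x) ¬Az) xz) (all-β (Ay , y≢x) ¬Az)
            go (no ¬Ay) (yes Az) = trans (B.triangle xy (B.~-sym (across (Az , z≢x) ¬Ay)) xz)
                                     (trans (B.col-sym y z) (all-β (Az , z≢x) ¬Ay))
            go (yes Ay) (yes Az) = trans
              (B.square xy (across (Ay , y≢x) ¬Aa) (B.~-sym (across (Az , z≢x) ¬Aa)) (B.~-sym xz) (R.~⇒≢ xa) y≢z)
              (trans (B.col-sym a z) (all-β (Az , z≢x) ¬Aa))
            go (no ¬Ay) (no ¬Az) = trans
              (B.square xy (B.~-sym (across am ¬Ay)) (across am ¬Az) (B.~-sym xz) (R.~⇒≢ xm) y≢z)
              (all-β am ¬Az)

          both : ⊥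
          both = not-B2 (B.one-more x (β ∷ []) (λ u v u≢x v≢x uv → here (off-x u v u≢x v≢x uv))
            λ y z y≢z xy xz → inj₁ (here (at-x y z y≢z xy xz)))

        -- If a is alone outside A, or m is alone in A besides x, that vertex has x as its only red
        -- neighbor and `no-pendant` applies. Otherwise both sides have two vertices.
        mixed : ⊥
        mixed = ¬¬-Π (λ v → ¬¬-excluded-middle) decided
          where
          decided : ¬ (∀ v → Dec (A v))
          decided A? with any? (λ b → ¬? (A? b) ×-dec ¬? (b ≟ a))
          ... | no none = no-pendant (R.~-sym xa) λ {w} w≢a w≢x → B.~-sym
            (blue-across (decidable-stable (A? w) λ ¬Aw → none (w , ¬Aw , w≢a)) w≢x ¬Aa)
          ... | yes (b , ¬Ab , b≢a) with any? (λ m′ → A? m′ ×-dec ¬? (m′ ≟ x) ×-dec ¬? (m′ ≟ m))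
          ...   | no none = no-pendant (R.~-sym xm) λ {w} w≢m w≢x →
            blue-across Am (x≢ xm) λ Aw → none (w , Aw , w≢x , w≢m)
          ...   | yes (m′ , Am′ , m′≢x , m′≢m) = Both.both A? Am′ m′≢x m′≢m ¬Ab b≢a

    critical : ⊥
    critical with any? (λ m → (x R.~? m) ×-dec ¬? (R.col x m ℕ.≟ R.col x a))
    ... | yes (m , xm , ≢i) = Mixed.mixed xm ≢i
    ... | no none = AllCritical.all-critical λ y xy →
      decidable-stable (_ ℕ.≟ _) λ ≢i → none (y , xy , ≢i)

-- Counting the colors of an MD-coloring

-- The relations are simply pulled back, so i ⊢ u ≈ v may still be witnessed by paths through
-- deleted vertices.
restrict : (f : Fin m → Fin n) → (∀ {i j} → f i ≡ f j → i ≡ j) → MDStructure n → MDStructure m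
restrict f f-injective M = record
  { _~_     = λ u v → f u ~ f v
  ; _~?_    = λ u v → f u ~? f v
  ; ~-sym   = ~-sym
  ; ~⇒≢     = λ e → ~⇒≢ e ∘ cong f
  ; col     = λ u v → col (f u) (f v)
  ; col-sym = λ u v → col-sym (f u) (f v)
  ; _⊢_≈_   = λ i u v → i ⊢ f u ≈ f v
  ; ≈-refl  = ≈-refl
  ; ≈-sym   = ≈-sym
  ; ≈-trans = ≈-trans
  ; ≈-edge  = ≈-edge
  ; ≈-sep   = λ u≢v → ≈-sep (u≢v ∘ f-injective)
  }
  where open MDStructure M

restrict-complementary : {R B : MDStructure n} (f : Fin m → Fin n)
  (f-injective : ∀ {i j} → f i ≡ f j → i ≡ j) → Complementary R B →
  Complementary (restrict f f-injective R) (restrict f f-injective B)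
restrict-complementary f f-injective compl = record
  { total = λ u≢v → total (u≢v ∘ f-injective) ; excl = excl }
  where open Complementary compl

few-sym : ∀ {n} {R B : MDStructure n} → Few R B → Few B R
few-sym (inj₁ r₂)              = inj₂ (inj₁ r₂)
few-sym (inj₂ (inj₁ b₂))       = inj₁ b₂
few-sym (inj₂ (inj₂ (r₃ , b₃))) = inj₂ (inj₂ (b₃ , r₃))

HasCriticalColor : MDStructure n → Fin n → Set
HasCriticalColor M x =
  ∃[ a ] x ~ a × (∀ u v → u ≢ x → v ≢ x → u ~ v → col u v ≢ col x a)
  where open MDStructure M

-- A color at `zero` that is not critical recurs on an edge off `zero`, where L covers it already.
extend-cover : (M : MDStructure (suc n)) → ¬ HasCriticalColor M zero →
               MDStructure.AtMost (restrict suc suc-injective M) k → MDStructure.AtMost M k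
extend-cover M ¬crit (L , L≤k , covers) = L , L≤k ,
  covers-at zero off-zero λ z e → ∈-stable λ z∉ →
    ¬crit (z , e , λ u v u≢0 v≢0 uv eq → z∉ (subst (_∈ L) eq (off-zero u v u≢0 v≢0 uv)))
  where
  open MDStructure M
  off-zero : ∀ u v → u ≢ zero → v ≢ zero → u ~ v → col u v ∈ L
  off-zero zero    _       u≢0 _   _  = ⊥-elim (u≢0 refl)
  off-zero (suc u) zero    _   v≢0 _  = ⊥-elim (v≢0 refl)
  off-zero (suc u) (suc v) _   _   uv = covers u v uv

few-step : 6 ≤ suc n → {R B : MDStructure (suc n)} → Complementary R B →
           ¬ ¬ Few (restrict suc suc-injective R) (restrict suc suc-injective B) → ¬ ¬ Few R B
few-step 6≤ {R} {B} compl IH many = ¬¬-excluded-middle {A = HasCriticalColor R zero} λ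
  { (yes (_ , xa , crit)) → Critical.critical 6≤ compl many xa crit
  ; (no ¬critR) → ¬¬-excluded-middle {A = HasCriticalColor B zero} λ
    { (yes (_ , xa , crit)) →
        Critical.critical 6≤ (complementary-sym compl) (many ∘ few-sym {R = B} {B = R}) xa crit
    ; (no ¬critB) → IH λ few → many (extend ¬critR ¬critB few) } }
  where
  extend : ¬ HasCriticalColor R zero → ¬ HasCriticalColor B zero →
           Few (restrict suc suc-injective R) (restrict suc suc-injective B) → Few R B
  extend ¬critR ¬critB (inj₁ r₂)               = inj₁ (extend-cover R ¬critR r₂)
  extend ¬critR ¬critB (inj₂ (inj₁ b₂))        = inj₂ (inj₁ (extend-cover B ¬critB b₂))
  extend ¬critR ¬critB (inj₂ (inj₂ (r₃ , b₃))) =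
    inj₂ (inj₂ (extend-cover R ¬critR r₃ , extend-cover B ¬critB b₃))

lookup-injective : ∀ {A : Set} {xs : List A} → Unique xs →
                   ∀ {i j} → lookup xs i ≡ lookup xs j → i ≡ j
lookup-injective (_ ∷ _)    {zero}  {zero}  _ = refl
lookup-injective (x∉ ∷ _)   {zero}  {suc j} e = ⊥-elim (All.lookup x∉ (∈-lookup j) e)
lookup-injective (x∉ ∷ _)   {suc i} {zero}  e = ⊥-elim (All.lookup x∉ (∈-lookup i) (sym e))
lookup-injective (_ ∷ xs!)  {suc i} {suc j} e = cong suc (lookup-injective xs! e)

unique-length : ∀ {A : Set} {xs ys : List A} → Unique xs → (∀ {x} → x ∈ xs → x ∈ ys) →
                length xs ≤ length ys
unique-length {xs = xs} {ys} xs! xs⊆ys = injective⇒≤ {f = λ i → index (member i)} inj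
  where
  member : ∀ i → lookup xs i ∈ ys
  member i = xs⊆ys (∈-lookup i)
  inj : ∀ {i j} → index (member i) ≡ index (member j) → i ≡ j
  inj {i} {j} e = lookup-injective xs! (trans (lookup-index (member i))
    (trans (cong (lookup ys) e) (sym (lookup-index (member j)))))

-- The spanning-tree bound

module _ {k} (M : MDStructure (suc k)) where
  open MDStructure M
  open DecMembership (_≟_ {suc k}) using () renaming (_∈?_ to _∈ᶠ?_)

  private
    root : Fin (suc k)
    root = zero

    vertices≤ : {vs : List (Fin (suc k))} → Unique vs → length vs ≤ suc k
    vertices≤ {vs} vs! = subst (length vs ≤_) (length-tabulate (λ i → i))
      (unique-length vs! λ {v} _ → ∈-allFin v)

    crossing : ∀ {vs u v} → Star _~_ u v → u ∈ vs → v ∉ vs → ∃[ x ] ∃[ y ] x ∈ vs × y ∉ vs × x ~ y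
    crossing ε u∈ v∉ = ⊥-elim (v∉ u∈)
    crossing {vs} (_◅_ {j = w} uw s) u∈ v∉ with w ∈ᶠ? vs
    ... | yes w∈ = crossing s w∈ v∉
    ... | no w∉  = _ , w , u∈ , w∉ , uw

    -- L lists the colors of a tree spanning vs, so a color outside L joins `root` to all of vs.
    -- Once vs is everything, an edge of such a color would have its own ends joined. The fuel d
    -- reaches 0 only if vs had k + 2 distinct vertices.
    grow : (∀ v → Star _~_ root v) → ∀ d vs L → Unique vs → length vs + d ≡ suc (suc k) →
           length vs ≡ suc (length L) → root ∈ vs →
           (∀ {v i} → v ∈ vs → i ∉ L → i ⊢ root ≈ v) → AtMost k
    grow conn zero vs L vs! fuel _ _ _ = ⊥-elim (ℕ.1+n≰n
      (subst (_≤ suc k) (trans (sym (ℕ.+-identityʳ _)) fuel) (vertices≤ vs!)))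
    grow conn (suc d) vs L vs! fuel len root∈ joined with any? (λ v → ¬? (v ∈ᶠ? vs))
    ... | no none = L , ℕ.≤-pred (subst (_≤ suc k) len (vertices≤ vs!)) , λ u v uv →
      ∈-stable λ c∉ → edge-sep uv (≈-trans (≈-sym (joined (all∈ u) c∉)) (joined (all∈ v) c∉))
      where
      all∈ : ∀ v → v ∈ vs
      all∈ v = decidable-stable (v ∈ᶠ? vs) λ v∉ → none (v , v∉)
    ... | yes (v , v∉) with crossing (conn v) root∈ v∉
    ...   | x , y , x∈ , y∉ , xy = grow conn d (y ∷ vs) (col x y ∷ L)
      (All.tabulate (λ w∈ e → y∉ (subst (_∈ vs) (sym e) w∈)) ∷ vs!)
      (trans (sym (ℕ.+-suc (length vs) d)) fuel) (cong suc len) (there root∈) λ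
        { (here refl) i∉ → ≈-trans (joined x∈ (i∉ ∘ there)) (≈-edge xy (i∉ ∘ here ∘ sym))
        ; (there w∈) i∉ → joined w∈ (i∉ ∘ there) }

  spanning-bound : (∀ v → Star _~_ root v) → AtMost k
  spanning-bound conn = grow conn (suc k) (root ∷ []) [] ([] ∷ []) refl refl 1st
    λ { (here refl) _ → ≈-refl }

-- Structures from MD-colorings

module _ {G : Graph n} (c : EdgeColoring G k) (c-md : IsMDColoring c) where
  open Graph G

  private
    color : Fin n → Fin n → ℕ
    color u v with T? (adj u v)
    ... | yes e = toℕ (at c e)
    ... | no _  = 0

    color-at : ∀ {u v} (e : u ~ v) → color u v ≡ toℕ (at c e)
    color-at {u} {v} e with T? (adj u v)
    ... | yes e′ = cong (toℕ ∘ at c) (T-irrelevant e′ e)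
    ... | no ¬e  = ⊥-elim (¬e e)

    flip~ : ∀ {u v} → u ~ v → v ~ u
    flip~ {u} {v} = subst T (symm u v)

    color-sym : ∀ u v → color u v ≡ color v u
    color-sym u v with T? (adj u v) | T? (adj v u)
    ... | yes e | yes f = cong toℕ (at-symm c e f)
    ... | yes e | no ¬f = ⊥-elim (¬f (flip~ e))
    ... | no ¬e | yes f = ⊥-elim (¬e (flip~ f))
    ... | no _  | no _  = refl

    Avoiding : ℕ → Fin n → Fin n → Set
    Avoiding i u v = u ~ v × color u v ≢ i

    separated : ∀ {u v} → u ≢ v → ¬ (∀ i → Star (Avoiding i) u v)
    separated u≢v joined with c-md _ _ u≢v
    ... | M , mono , cut = ¬¬-excluded-middle {A = ∃[ x ] ∃[ y ] Σ[ e ∈ x ~ y ] T (at M e)} λ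
      { (yes (x , y , e , e∈)) → cut (gmap (λ w → w)
          (λ (f , ≢i) → f , λ f∈ → ≢i (trans (color-at f)
            (cong toℕ (mono f e f∈ e∈)))) (joined (toℕ (at c e))))
      -- An empty cut is avoided by every path, so the color 0 is an arbitrary choice.
      ; (no none) → cut (gmap (λ w → w) (λ (f , _) → f , λ f∈ → none (_ , _ , f , f∈)) (joined 0)) }

  structure : MDStructure n
  structure = record
    { _~_     = _~_
    ; _~?_    = λ u v → T? (adj u v)
    ; ~-sym   = flip~
    ; ~⇒≢     = λ { e refl → subst T (irrefl _) e }
    ; col     = color
    ; col-sym = color-sym
    ; _⊢_≈_   = λ i → Star (Avoiding i)
    ; ≈-refl  = ε
    ; ≈-sym   = reverse λ (e , ≢i) → flip~ e , λ eq → ≢i (trans (color-sym _ _) eq)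
    ; ≈-trans = _◅◅_
    ; ≈-edge  = λ e ≢i → (e , ≢i) ◅ ε
    ; ≈-sep   = separated
    }

  numColors≤ : ∀ {m} → MDStructure.AtMost structure m → numColors c ≤ m
  numColors≤ (L , L≤m , covers) = ≤-trans
    (subst (_≤ length L) (length-map toℕ used)
      (unique-length (map⁺ toℕ-injective (filter⁺ (used? c) (allFin⁺ k))) used⊆L)) L≤m
    where
    used : List (Fin k)
    used = filter (used? c) (allFin k)

    used⊆L : ∀ {x} → x ∈ map toℕ used → x ∈ L
    used⊆L x∈ with ∈-map⁻ toℕ x∈
    ... | i , i∈ , refl with ∈-filter⁻ (used? c) {xs = allFin k} i∈
    ...   | _ , u , v , e , refl = subst (_∈ L) (color-at e) (covers u v e)

-- Colors forced by triangles and 4-cycles in a given graph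

Adj : ℕ → Set
Adj n = Fin n → Fin n → Bool

_Realizes_ : MDStructure n → Adj n → Set
M Realizes a = ∀ {u v} → (u ~ v → T (a u v)) × (T (a u v) → u ~ v)
  where open MDStructure M

module Forced {n} (a : Adj n) where

  Edge : Set
  Edge = Fin n × Fin n

  -- Either u v and u z are sides of a triangle, or u v and w z are opposite sides of the 4-cycle u
  -- v w z. `Linked` tries all orientations.
  Step : Fin n → Fin n → Fin n → Fin n → Set
  Step u v w z = (u ≡ w × T (a v z)) ⊎ (T (a v w) × T (a z u) × u ≢ w × v ≢ z)

  step? : ∀ u v w z → Dec (Step u v w z)
  step? u v w z = ((u ≟ w) ×-dec T? (a v z)) ⊎-dec
    (T? (a v w) ×-dec T? (a z u) ×-dec ¬? (u ≟ w) ×-dec ¬? (v ≟ z))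

  Linked : Edge → Edge → Set
  Linked (u , v) (w , z) = (Step u v w z ⊎ Step v u w z) ⊎ (Step u v z w ⊎ Step v u z w)

  linked? : ∀ e f → Dec (Linked e f)
  linked? (u , v) (w , z) =
    (step? u v w z ⊎-dec step? v u w z) ⊎-dec (step? u v z w ⊎-dec step? v u z w)

  near? : ∀ S f → Dec (Any (Linked f) S)
  near? S f = Any.any? (linked? f) S

  -- The edges of es not forced, within k rounds, to the color of those in S.
  remaining : ℕ → List Edge → List Edge → List Edge
  remaining zero    S       es = es
  remaining (suc k) []      es = es
  remaining (suc k) (s ∷ S) es =
    remaining k (filter (near? (s ∷ S)) es) (filter (¬? ∘ near? (s ∷ S)) es)

  -- Running out of fuel only lists more edges, so soundness does not depend on the number of
  -- rounds.
  representatives : ℕ → List Edge → List Edge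
  representatives zero    es       = es
  representatives (suc k) []       = []
  representatives (suc k) (e ∷ es) = e ∷ representatives k (remaining (suc k) (e ∷ []) es)

  edges : List Edge
  edges = filter (λ (u , v) → (u Fin.<? v) ×-dec T? (a u v)) (cartesianProduct (allFin n) (allFin n))

  classes : List Edge
  classes = representatives (length edges) edges

  -- A 5-cycle contains neither triangle nor 4-cycle. A closed walk of length 5 through a
  -- representative of every class, in either orientation, still bounds the number of colors by 2.
  Pentagon : Set
  Pentagon = ∃[ u ] ∃[ v ] T (a u v) × ∃[ w ] T (a v w) × ∃[ y ] T (a w y) ×
    ∃[ z ] T (a y z) × T (a z u) ×
    All (_∈ (u , v) ∷ (v , w) ∷ (w , y) ∷ (y , z) ∷ (z , u) ∷
            (v , u) ∷ (w , v) ∷ (y , w) ∷ (z , y) ∷ (u , z) ∷ []) classes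

  pentagon? : Dec Pentagon
  pentagon? = any? λ u → any? λ v → T? (a u v) ×-dec any? λ w → T? (a v w) ×-dec
    any? λ y → T? (a w y) ×-dec any? λ z → T? (a y z) ×-dec T? (a z u) ×-dec
    All.all? (_∈ᵉ? _) classes
    where open DecMembership (≡-dec (_≟_ {n}) (_≟_ {n}))
            using () renaming (_∈?_ to _∈ᵉ?_)

  module Sound (M : MDStructure n) (M-a : M Realizes a) where
    open MDStructure M

    private
      edge : ∀ {u v} → T (a u v) → u ~ v
      edge = proj₂ M-a

      Real : Edge → Set
      Real (u , v) = u ~ v

      colₑ : Edge → ℕ
      colₑ (u , v) = col u v

      step-col : ∀ {u v w z} → u ~ v → w ~ z → Step u v w z → col u v ≡ col w z
      step-col uv wz (inj₁ (refl , vz))            = triangle′ uv (edge vz) wz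
      step-col uv wz (inj₂ (vw , zu , u≢w , v≢z)) = square uv (edge vw) wz (edge zu) u≢w v≢z

      linked-col : ∀ {e f} → Real e → Real f → Linked e f → colₑ e ≡ colₑ f
      linked-col uv wz (inj₁ (inj₁ s)) = step-col uv wz s
      linked-col uv wz (inj₁ (inj₂ s)) = trans (col-sym _ _) (step-col (~-sym uv) wz s)
      linked-col uv wz (inj₂ (inj₁ s)) = trans (step-col uv (~-sym wz) s) (col-sym _ _)
      linked-col uv wz (inj₂ (inj₂ s)) =
        trans (col-sym _ _) (trans (step-col (~-sym uv) (~-sym wz) s) (col-sym _ _))

      remaining-⊆ : ∀ k S es {e} → e ∈ remaining k S es → e ∈ es
      remaining-⊆ zero    S       es e∈ = e∈
      remaining-⊆ (suc k) []      es e∈ = e∈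
      remaining-⊆ (suc k) (s ∷ S) es e∈ = proj₁ (∈-filter⁻ (¬? ∘ near? (s ∷ S)) {xs = es}
        (remaining-⊆ k (filter (near? (s ∷ S)) es) (filter (¬? ∘ near? (s ∷ S)) es) e∈))

      near-κ : ∀ {S f κ} → (∀ {s} → s ∈ S → Real s × colₑ s ≡ κ) → Real f → Any (Linked f) S →
               colₑ f ≡ κ
      near-κ S-κ f near with find near
      ... | s , s∈ , l = trans (linked-col f (proj₁ (S-κ s∈)) l) (proj₂ (S-κ s∈))

      remaining-sound : ∀ k S es {κ} → (∀ {e} → e ∈ es → Real e) →
        (∀ {s} → s ∈ S → Real s × colₑ s ≡ κ) →
        ∀ {e} → e ∈ es → colₑ e ≡ κ ⊎ e ∈ remaining k S es
      remaining-sound zero    S       es _ _ e∈ = inj₂ e∈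
      remaining-sound (suc k) []      es _ _ e∈ = inj₂ e∈
      remaining-sound (suc k) (s ∷ S) es real S-κ {e} e∈ with near? (s ∷ S) e
      ... | yes near = inj₁ (near-κ S-κ (real e∈) near)
      ... | no ¬near = remaining-sound k (filter (near? (s ∷ S)) es) (filter (¬? ∘ near? (s ∷ S)) es)
        (real ∘ proj₁ ∘ ∈-filter⁻ (¬? ∘ near? (s ∷ S)) {xs = es})
        (λ f∈ → let (f∈′ , near) = ∈-filter⁻ (near? (s ∷ S)) {xs = es} f∈ in
          real f∈′ , near-κ S-κ (real f∈′) near)
        (∈-filter⁺ (¬? ∘ near? (s ∷ S)) e∈ ¬near)

      representatives-sound : ∀ k es → (∀ {e} → e ∈ es → Real e) →
        ∀ {e} → e ∈ es → colₑ e ∈ map colₑ (representatives k es)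
      representatives-sound zero    es       real e∈ = ∈-map⁺ colₑ e∈
      representatives-sound (suc k) (e ∷ es) real (here refl) = here refl
      representatives-sound (suc k) (e ∷ es) real (there f∈)
        with remaining-sound (suc k) (e ∷ []) es (real ∘ there)
               (λ { (here refl) → real (here refl) , refl }) f∈
      ... | inj₁ f-κ = here f-κ
      ... | inj₂ f∈′ = there (representatives-sound k (remaining (suc k) (e ∷ []) es)
        (real ∘ there ∘ remaining-⊆ (suc k) (e ∷ []) es) f∈′)

      edges-real : ∀ {e} → e ∈ edges → Real e
      edges-real e∈ = edge (proj₂ (proj₂ (∈-filter⁻
        (λ (u , v) → (u Fin.<? v) ×-dec T? (a u v)) {xs = cartesianProduct (allFin n) (allFin n)} e∈)))

      edges-complete : ∀ {u v} → u Fin.< v → u ~ v → (u , v) ∈ edges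
      edges-complete u<v uv = ∈-filter⁺ (λ (u , v) → (u Fin.<? v) ×-dec T? (a u v))
        (∈-cartesianProduct⁺ (∈-allFin _) (∈-allFin _)) (u<v , proj₁ M-a uv)

    covers-classes : Covers (map colₑ classes)
    covers-classes u v uv with <-cmp u v
    ... | tri< u<v _ _  = representatives-sound (length edges) edges edges-real (edges-complete u<v uv)
    ... | tri≈ _ u≡v _  = ⊥-elim (~⇒≢ uv u≡v)
    ... | tri> _ _ v<u  = col-flip
      (representatives-sound (length edges) edges edges-real (edges-complete v<u (~-sym uv)))

    atMost-classes : length classes ≤ m → AtMost m
    atMost-classes ≤m = map colₑ classes , subst (_≤ _) (sym (length-map colₑ classes)) ≤m , covers-classes

    atMost-pentagon : Pentagon → AtMost 2
    atMost-pentagon (u , v , uv , w , vw , y , wy , z , yz , zu , on-cycle)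
      with pentagon (edge uv) (edge vw) (edge wy) (edge yz) (edge zu)
    ... | p , q , uv∈ , vw∈ , wy∈ , yz∈ , zu∈ = p ∷ q ∷ [] , ≤-refl , covers
      where
      on : ∀ {e} → e ∈ classes → colₑ e ∈ p ∷ q ∷ []
      on e∈ = All.lookup
        (uv∈ ∷ vw∈ ∷ wy∈ ∷ yz∈ ∷ zu∈ ∷ col-flip uv∈ ∷ col-flip vw∈ ∷ col-flip wy∈ ∷
         col-flip yz∈ ∷ col-flip zu∈ ∷ []) (All.lookup on-cycle e∈)
      covers : Covers (p ∷ q ∷ [])
      covers x x′ e with ∈-map⁻ colₑ (covers-classes x x′ e)
      ... | _ , r∈ , eq = subst (_∈ _) (sym eq) (on r∈)

-- Symmetric irreflexive adjacency matrices, given by the entries above the diagonal.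
Upper : ℕ → Set
Upper zero    = ⊤
Upper (suc n) = Vec Bool n × Upper n

entry : Upper n → Adj n
entry (r , t) zero    zero    = false
entry (r , t) zero    (suc v) = Vec.lookup r v
entry (r , t) (suc u) zero    = Vec.lookup r u
entry (r , t) (suc u) (suc v) = entry t u v

upper : Adj n → Upper n
upper {zero}  a = tt
upper {suc n} a = Vec.tabulate (a zero ∘ suc) , upper λ u v → a (suc u) (suc v)

entry-upper : (a : Adj n) → (∀ u v → a u v ≡ a v u) → (∀ v → a v v ≡ false) →
              ∀ u v → entry (upper a) u v ≡ a u v
entry-upper a a-sym a-irr zero    zero    = sym (a-irr zero)
entry-upper a a-sym a-irr zero    (suc v) = lookup∘tabulate (a zero ∘ suc) v
entry-upper a a-sym a-irr (suc u) zero    =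
  trans (lookup∘tabulate (a zero ∘ suc) u) (a-sym zero (suc u))
entry-upper a a-sym a-irr (suc u) (suc v) =
  entry-upper (λ u v → a (suc u) (suc v)) (λ u v → a-sym (suc u) (suc v)) (a-irr ∘ suc) u v

complement : Adj n → Adj n
complement a u v = not (does (u ≟ v)) ∧ not (a u v)

allVec? : {P : Vec Bool n → Set} → (∀ v → Dec (P v)) → Dec (∀ v → P v)
allVec? {zero}  P? = map′ (λ p → λ { [] → p }) (λ p → p []) (P? [])
allVec? {suc n} P? = map′ (λ (p , q) → λ { (false ∷ v) → p v ; (true ∷ v) → q v })
  (λ p → (λ v → p (false ∷ v)) , λ v → p (true ∷ v))
  (allVec? (λ v → P? (false ∷ v)) ×-dec allVec? (λ v → P? (true ∷ v)))

allUpper? : {P : Upper n → Set} → (∀ t → Dec (P t)) → Dec (∀ t → P t)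
allUpper? {zero}  P? = map′ (λ p _ → p) (λ p → p tt) (P? tt)
allUpper? {suc n} P? = map′ (λ p (r , t) → p r t) (λ p r t → p (r , t))
  (allVec? λ r → allUpper? λ t → P? (r , t))

FewClasses : Adj n → Set
FewClasses a = length (classes a) ≤ 2 ⊎ length (classes (complement a)) ≤ 2 ⊎
  (length (classes a) ≤ 3 × length (classes (complement a)) ≤ 3) ⊎ Pentagon a
  where open Forced

fewClasses? : (a : Adj n) → Dec (FewClasses a)
fewClasses? a = (length (classes a) ℕ.≤? 2) ⊎-dec (length (classes (complement a)) ℕ.≤? 2) ⊎-dec
  ((length (classes a) ℕ.≤? 3) ×-dec (length (classes (complement a)) ℕ.≤? 3)) ⊎-dec pentagon? a
  where open Forced

opaque
  -- The base case of the induction, evaluated on all 1024 labeled graphs of order 5.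
  fewClasses₅ : (t : Upper 5) → FewClasses (entry t)
  fewClasses₅ = from-yes (allUpper? {n = 5} λ t → fewClasses? (entry t))

-- Bounds for md

T-does⁺ : {P : Set} (P? : Dec P) → P → T (does P?)
T-does⁺ (yes _) _ = _
T-does⁺ (no ¬p) p = ⊥-elim (¬p p)

T-does⁻ : {P : Set} (P? : Dec P) → T (does P?) → P
T-does⁻ (yes p) _ = p

complement⁺ : ∀ (a : Adj n) {u v} → u ≢ v → ¬ T (a u v) → T (complement a u v)
complement⁺ a {u} {v} u≢v ¬uv with u ≟ v | a u v
... | yes u≡v | _     = ⊥-elim (u≢v u≡v)
... | no _    | true  = ⊥-elim (¬uv _)
... | no _    | false = _

complement⁻ : ∀ (a : Adj n) {u v} → T (complement a u v) → u ≢ v × ¬ T (a u v)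
complement⁻ a {u} {v} e with u ≟ v | a u v
... | no u≢v | false = u≢v , λ ()

few₅ : {R B : MDStructure 5} → Complementary R B → Few R B
few₅ {R} {B} compl = conclude (fewClasses₅ (upper a))
  where
  module R = MDStructure R
  module B = MDStructure B
  open Complementary compl

  a : Adj 5
  a u v = does (u R.~? v)

  a-sym : ∀ u v → a u v ≡ a v u
  a-sym u v with v R.~? u
  ... | yes e = dec-true (u R.~? v) (R.~-sym e)
  ... | no ¬e = dec-false (u R.~? v) (¬e ∘ R.~-sym)

  a-irr : ∀ v → a v v ≡ false
  a-irr v = dec-false (v R.~? v) λ e → R.~⇒≢ e refl

  entry-a : ∀ u v → entry (upper a) u v ≡ a u v
  entry-a = entry-upper a a-sym a-irr

  R-entry : R Realizes entry (upper a)
  R-entry {u} {v} = (λ e → subst T (sym (entry-a u v)) (T-does⁺ (u R.~? v) e)) ,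
    λ t → T-does⁻ (u R.~? v) (subst T (entry-a u v) t)

  B-entry : B Realizes complement (entry (upper a))
  B-entry {u} {v} =
    (λ e → complement⁺ (entry (upper a)) (B.~⇒≢ e) λ t → excl (proj₂ R-entry t) e) ,
    λ t → let (u≢v , ¬t) = complement⁻ (entry (upper a)) t in blue u≢v (¬t ∘ proj₁ R-entry)

  conclude : FewClasses (entry (upper a)) → Few R B
  conclude (inj₁ r₂)                     = inj₁ (Forced.Sound.atMost-classes _ R R-entry r₂)
  conclude (inj₂ (inj₁ b₂))              = inj₂ (inj₁ (Forced.Sound.atMost-classes _ B B-entry b₂))
  conclude (inj₂ (inj₂ (inj₁ (r₃ , b₃)))) =
    inj₂ (inj₂ (Forced.Sound.atMost-classes _ R R-entry r₃ , Forced.Sound.atMost-classes _ B B-entry b₃))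
  conclude (inj₂ (inj₂ (inj₂ pent)))     = inj₁ (Forced.Sound.atMost-pentagon _ R R-entry pent)

few : 5 ℕ.≤′ n → {R B : MDStructure n} → Complementary R B → ¬ ¬ Few R B
few ℕ.≤′-refl       compl many = many (few₅ compl)
few (ℕ.≤′-step 5≤n) compl = few-step (s≤s (ℕ.≤′⇒≤ 5≤n)) compl
  (few 5≤n (restrict-complementary suc suc-injective compl))

structure-complementary : {G : Graph n} {k l : ℕ}
  (c : EdgeColoring G k) (c-md : IsMDColoring c) (d : EdgeColoring (∁ G) l) (d-md : IsMDColoring d) →
  Complementary (structure c c-md) (structure d d-md)
structure-complementary {G = G} c c-md d d-md = record
  { total = total
  ; excl  = λ e e′ → proj₂ (complement⁻ (Graph.adj G) e′) e
  }
  where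
  open Graph G
  total : ∀ {u v} → u ≢ v → u ~ v ⊎ Graph._~_ (∁ G) u v
  total {u} {v} u≢v with T? (adj u v)
  ... | yes e = inj₁ e
  ... | no ¬e = inj₂ (complement⁺ adj u≢v ¬e)

md≤ : (G : Graph n) → (∀ {k} (c : EdgeColoring G k) (c-md : IsMDColoring c) →
      MDStructure.AtMost (structure c c-md) m) → md G ≤ m
md≤ {m = m} G bound with md-spec G
... | (_ , c , c-md , eq) , _ = subst (_≤ m) eq (numColors≤ c c-md (bound c c-md))

md-few : 5 ≤ n → (G : Graph n) → md G ≤ 2 ⊎ md (∁ G) ≤ 2 ⊎ (md G ≤ 3 × md (∁ G) ≤ 3)
md-few 5≤n G with md-spec G | md-spec (∁ G)
... | (_ , c , c-md , eq) , _ | (_ , d , d-md , eq′) , _ =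
  -- The claim is now about numbers, hence decidable, and the double negation of `few` disappears.
  decidable-stable dec λ many → few (ℕ.≤⇒≤′ 5≤n) (structure-complementary c c-md d d-md) (many ∘ conclude)
  where
  dec = (md G ℕ.≤? 2) ⊎-dec (md (∁ G) ℕ.≤? 2) ⊎-dec ((md G ℕ.≤? 3) ×-dec (md (∁ G) ℕ.≤? 3))
  g : ∀ {m} → MDStructure.AtMost (structure c c-md) m → md G ≤ m
  g = subst (_≤ _) eq ∘ numColors≤ c c-md
  h : ∀ {m} → MDStructure.AtMost (structure d d-md) m → md (∁ G) ≤ m
  h = subst (_≤ _) eq′ ∘ numColors≤ d d-md
  conclude : Few (structure c c-md) (structure d d-md) →
             md G ≤ 2 ⊎ md (∁ G) ≤ 2 ⊎ (md G ≤ 3 × md (∁ G) ≤ 3)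
  conclude (inj₁ r₂)               = inj₁ (g r₂)
  conclude (inj₂ (inj₁ b₂))        = inj₂ (inj₁ (h b₂))
  conclude (inj₂ (inj₂ (r₃ , b₃))) = inj₂ (inj₂ (g r₃ , h b₃))

md-connected : (G : Graph (suc k)) → Connected G → md G ≤ k
md-connected G conn = md≤ G λ c c-md → spanning-bound (structure c c-md) (conn zero)

md-product : 5 ≤ n → (G : Graph n) → Connected G → Connected (∁ G) →
             md G * md (∁ G) ≤ 9 ⊎ md G * md (∁ G) ≤ 2 * (n ∸ 1)
md-product {suc k} 5≤n G conn conn′ with md-few 5≤n G
... | inj₁ g₂                = inj₂ (ℕ.*-mono-≤ g₂ (md-connected (∁ G) conn′))
... | inj₂ (inj₁ h₂)         = inj₂ (subst (md G * md (∁ G) ≤_) (ℕ.*-comm k 2)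
                                 (ℕ.*-mono-≤ (md-connected G conn) h₂))
... | inj₂ (inj₂ (g₃ , h₃))  = inj₁ (ℕ.*-mono-≤ g₃ h₃)

-- Labels, one coordinate per color, such that adjacent vertices differ in a
-- single coordinate: coordinate i then separates whenever its values differ.
module _ {k} (G : Graph n) (lab : Fin k → Fin n → ℕ)
  (single : ∀ {u v} → Graph._~_ G u v → ∃[ i ] (∀ j → j ≢ i → lab j u ≡ lab j v))
  (distinct : ∀ {u v} → u ≢ v → ∃[ i ] lab i u ≢ lab i v)
  where
  open Graph G

  private
    ~⇒≢ : ∀ {u v} → u ~ v → u ≢ v
    ~⇒≢ e refl = subst T (irrefl _) e

    differ : ∀ {u v} (e : u ~ v) → ∀ j → lab j u ≢ lab j v → j ≡ proj₁ (single e)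
    differ e j ≢lab = decidable-stable (j ≟ _) λ j≢ → ≢lab (proj₂ (single e) j j≢)

    coloring : EdgeColoring G k
    coloring = record { at = λ e → proj₁ (single e) ; at-symm = at-symm′ }
      where
      at-symm′ : ∀ {u v} (e : u ~ v) (e′ : v ~ u) → proj₁ (single e) ≡ proj₁ (single e′)
      at-symm′ e e′ with distinct (~⇒≢ e)
      ... | i , ≢lab = trans (sym (differ e i ≢lab)) (differ e′ i (≢-sym ≢lab))

    class : Fin k → EdgeSet G
    class i = record
      { at      = λ e → does (at coloring e ≟ i)
      ; at-symm = λ e e′ → cong (λ j → does (j ≟ i)) (at-symm coloring e e′)
      }

    constant : ∀ i {u v} → Star (Without (class i)) u v → lab i u ≡ lab i v
    constant i ε = refl
    constant i ((e , e∉) ◅ s) = trans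
      (proj₂ (single e) i λ i≡ → e∉ (T-does⁺ (at coloring e ≟ i) (sym i≡))) (constant i s)

    coloring-md : IsMDColoring coloring
    coloring-md u v u≢v with distinct u≢v
    ... | i , ≢lab = class i ,
      (λ e f e∈ f∈ → trans (T-does⁻ (_ ≟ i) e∈) (sym (T-does⁻ (_ ≟ i) f∈))) , ≢lab ∘ constant i

    -- On a path between vertices that differ in coordinate i, some edge changes that coordinate,
    -- and this edge has color i.
    used : Connected G → (∀ i → ∃[ u ] ∃[ v ] lab i u ≢ lab i v) → ∀ i → Used coloring i
    used conn varies i with varies i
    ... | u , v , ≢lab = along (conn u v) ≢lab
      where
      along : ∀ {u v} → Star _~_ u v → lab i u ≢ lab i v → Used coloring i
      along ε ≢lab = ⊥-elim (≢lab refl)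
      along {u} (_◅_ {j = w} e s) ≢lab with lab i u ℕ.≟ lab i w
      ... | yes eq = along s (≢lab ∘ trans eq)
      ... | no ≢w  = _ , _ , e , sym (differ e i ≢w)

  ≤md-labels : Connected G → (∀ i → ∃[ u ] ∃[ v ] lab i u ≢ lab i v) → k ≤ md G
  ≤md-labels conn varies = subst (_≤ md G) num (proj₂ (md-spec G) k coloring coloring-md)
    where
    num : numColors coloring ≡ k
    num = trans (cong length (filter-all (used? coloring) (universal (used conn varies) (allFin k))))
                (length-tabulate {n = k} (λ i → i))

-- Lower bounds for all graphs of a given small order

pairs : ∀ n → List (Fin n × Fin n)
pairs n = filter (λ (u , v) → u Fin.<? v) (cartesianProduct (allFin n) (allFin n))

-- A lower bound for md together with the pairs that may be adjacent for it to hold.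
Cert : Set
Cert = ℕ × List Bool

-- The best bound for each list of allowed pairs.
data Trie : Set where
  empty : Trie
  leaf  : ℕ → Trie
  node  : (forbidden allowed : Trie) → Trie

merge : Trie → Trie → Trie
merge empty      t            = t
merge (leaf a)   (leaf b)     = leaf (a ⊔ b)
merge (node f t) (node f′ t′) = node (merge f f′) (merge t t′)
merge s          _            = s

singleton : ℕ → List Bool → Trie
singleton w []          = leaf w
singleton w (true ∷ a)  = node empty (singleton w a)
singleton w (false ∷ a) = node (singleton w a) empty

trie : List Cert → Trie
trie = foldr (λ (w , a) → merge (singleton w a)) empty

-- Bounds in the forbidden branch need the pair to be nonadjacent, while those in the allowed branch
-- tolerate both; so nonadjacency keeps both branches.
if-adjacent if-not-adjacent : Trie → Trie
if-adjacent (node f t) = t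
if-adjacent _          = empty
if-not-adjacent (node f t) = merge f t
if-not-adjacent _          = empty

-- A connected graph with an edge has `md` at least 1, which serves as the default.
best : Trie → ℕ
best (leaf w) = w ⊔ 1
best _        = 1

-- Runs through all graphs, given by their first p pairs, keeping the bounds A for
-- the graph and B for its complement that are still available.
search : ℕ → ℕ → Trie → Trie → Bool
search target zero    A B = target ≤ᵇ best A * best B
search target (suc p) A B = search target p (if-adjacent A) (if-not-adjacent B) ∧
                            search target p (if-not-adjacent A) (if-adjacent B)

module _ (G : Graph n) where
  open Graph G

  Allowed : List (Fin n × Fin n) → List Bool → Set
  Allowed []             _       = ⊤
  Allowed (_ ∷ _)        []      = ⊥
  Allowed ((u , v) ∷ ps) (b ∷ a) = (u ~ v → T b) × Allowed ps a

  ValidCert : List (Fin n × Fin n) → Cert → Set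
  ValidCert ps (w , a) = Allowed ps a → w ≤ md G

  Valid : List (Fin n × Fin n) → Trie → Set
  Valid []             t          = best t ≤ md G
  Valid ((u , v) ∷ ps) (node f t) = (¬ u ~ v → Valid ps f) × Valid ps t
  Valid (_ ∷ _)        _          = ⊤

  module _ (1≤md : 1 ≤ md G) where

    empty-valid : ∀ ps → Valid ps empty
    empty-valid []      = 1≤md
    empty-valid (_ ∷ _) = tt

    merge-valid : ∀ ps {s t} → Valid ps s → Valid ps t → Valid ps (merge s t)
    merge-valid []       {empty}    {_}         _ y = y
    merge-valid []       {leaf _}   {empty}     x _ = x
    merge-valid []       {leaf a}   {leaf b}    x y =
      ℕ.⊔-lub (ℕ.⊔-lub (ℕ.m⊔n≤o⇒m≤o a 1 x) (ℕ.m⊔n≤o⇒m≤o b 1 y)) 1≤md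
    merge-valid []       {leaf _}   {node _ _}  x _ = x
    merge-valid []       {node _ _} {empty}     x _ = x
    merge-valid []       {node _ _} {leaf _}    x _ = x
    merge-valid []       {node _ _} {node _ _}  x _ = x
    merge-valid (_ ∷ _)  {empty}    {_}         _ y = y
    merge-valid (_ ∷ _)  {leaf _}   {empty}     x _ = tt
    merge-valid (_ ∷ _)  {leaf _}   {leaf _}    x _ = tt
    merge-valid (_ ∷ _)  {leaf _}   {node _ _}  x _ = tt
    merge-valid (_ ∷ _)  {node _ _} {empty}     x _ = x
    merge-valid (_ ∷ _)  {node _ _} {leaf _}    x _ = x
    merge-valid (_ ∷ ps) {node _ _} {node _ _}  (x , x′) (y , y′) =
      (λ ¬e → merge-valid ps (x ¬e) (y ¬e)) , merge-valid ps x′ y′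

    singleton-valid : ∀ ps w a → ValidCert ps (w , a) → Valid ps (singleton w a)
    singleton-valid []       w []          x = ℕ.⊔-lub (x tt) 1≤md
    singleton-valid []       w (true ∷ a)  x = 1≤md
    singleton-valid []       w (false ∷ a) x = 1≤md
    singleton-valid (_ ∷ _)  w []          x = tt
    singleton-valid (_ ∷ ps) w (true ∷ a)  x =
      (λ _ → empty-valid ps) , singleton-valid ps w a λ al → x ((λ _ → tt) , al)
    singleton-valid (_ ∷ ps) w (false ∷ a) x =
      (λ ¬e → singleton-valid ps w a λ al → x (¬e , al)) , empty-valid ps

    trie-valid : ∀ ps {A} → All (ValidCert ps) A → Valid ps (trie A)
    trie-valid ps []       = empty-valid ps
    trie-valid ps (v ∷ vs) = merge-valid ps (singleton-valid ps _ _ v) (trie-valid ps vs)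

    adjacent-valid : ∀ {p} ps t → Valid (p ∷ ps) t → Valid ps (if-adjacent t)
    adjacent-valid ps empty      _       = empty-valid ps
    adjacent-valid ps (leaf _)   _       = empty-valid ps
    adjacent-valid ps (node _ _) (_ , x) = x

    not-adjacent-valid : ∀ {u v} ps t → ¬ u ~ v → Valid ((u , v) ∷ ps) t → Valid ps (if-not-adjacent t)
    not-adjacent-valid ps empty      _  _       = empty-valid ps
    not-adjacent-valid ps (leaf _)   _  _       = empty-valid ps
    not-adjacent-valid ps (node _ _) ¬e (x , y) = merge-valid ps (x ¬e) y

search-sound : ∀ target {G H : Graph n} → (∀ {u v} → ¬ (Graph._~_ G u v × Graph._~_ H u v)) →
  1 ≤ md G → 1 ≤ md H → ∀ ps {A B} → T (search target (length ps) A B) →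
  Valid G ps A → Valid H ps B → target ≤ md G * md H
search-sound target {G} {H} disjoint 1≤G 1≤H [] ok vA vB =
  ≤-trans (ℕ.≤ᵇ⇒≤ _ _ ok) (ℕ.*-mono-≤ vA vB)
search-sound target {G} {H} disjoint 1≤G 1≤H ((u , v) ∷ ps) {A} {B} ok vA vB
  with Equivalence.to T-∧ ok | T? (Graph.adj G u v)
... | ok₁ , _ | yes e = search-sound target disjoint 1≤G 1≤H ps ok₁
  (adjacent-valid G 1≤G ps A vA) (not-adjacent-valid H 1≤H ps B (λ e′ → disjoint (e , e′)) vB)
... | _ , ok₂ | no ¬e = search-sound target disjoint 1≤G 1≤H ps ok₂
  (not-adjacent-valid G 1≤G ps A ¬e vA) (adjacent-valid H 1≤H ps B vB)

-- Certificates from placements and from vertex splits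

insertions : {A : Set} → A → Vec A n → List (Vec A (suc n))
insertions x []       = (x ∷ []) ∷ []
insertions x (y ∷ ys) = (x ∷ y ∷ ys) ∷ map (y ∷_) (insertions x ys)

permutations : {A : Set} → Vec A n → List (Vec A n)
permutations []       = [] ∷ []
permutations (x ∷ xs) = concatMap (insertions x) (permutations xs)

same : Vec ℕ k → Vec ℕ k → Bool
same []       []       = true
same (x ∷ xs) (y ∷ ys) = (x ≡ᵇ y) ∧ same xs ys

oneApart : Vec ℕ k → Vec ℕ k → Bool
oneApart []       []       = false
oneApart (x ∷ xs) (y ∷ ys) = if x ≡ᵇ y then oneApart xs ys else same xs ys

same-sound : (xs ys : Vec ℕ k) → T (same xs ys) → ∀ j → Vec.lookup xs j ≡ Vec.lookup ys j
same-sound (x ∷ xs) (y ∷ ys) t zero    = ℕ.≡ᵇ⇒≡ x y (proj₁ (Equivalence.to T-∧ t))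
same-sound (x ∷ xs) (y ∷ ys) t (suc j) = same-sound xs ys (proj₂ (Equivalence.to T-∧ t)) j

same-complete : (xs ys : Vec ℕ k) → ¬ T (same xs ys) → ∃[ j ] Vec.lookup xs j ≢ Vec.lookup ys j
same-complete []       []       ¬t = ⊥-elim (¬t tt)
same-complete (x ∷ xs) (y ∷ ys) ¬t with x ℕ.≟ y
... | no x≢y   = zero , x≢y
... | yes refl with same-complete xs ys (λ t → ¬t (Equivalence.from T-∧ (ℕ.≡⇒≡ᵇ x x refl , t)))
...   | j , ≢ = suc j , ≢

oneApart-sound : (xs ys : Vec ℕ k) → T (oneApart xs ys) →
               ∃[ i ] (∀ j → j ≢ i → Vec.lookup xs j ≡ Vec.lookup ys j)
oneApart-sound []       []       ()
oneApart-sound (x ∷ xs) (y ∷ ys) t with x ≡ᵇ y in eq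
... | false = zero , λ { zero j≢ → ⊥-elim (j≢ refl) ; (suc j) _ → same-sound xs ys t j }
... | true with oneApart-sound xs ys t
...   | i , agree = suc i , λ
        { zero _     → ℕ.≡ᵇ⇒≡ x y (subst T (sym eq) tt)
        ; (suc j) j≢ → agree j (j≢ ∘ cong suc) }

Placement : ℕ → ℕ → Set
Placement k n = Vec (Vec ℕ k) n

Proper : Placement k n → Set
Proper {k} {n} p =
  All (λ (u , v) → ¬ T (same (Vec.lookup p u) (Vec.lookup p v))) (pairs n) ×
  (∀ (i : Fin k) → ∃[ u ] ∃[ v ] Vec.lookup (Vec.lookup p u) i ≢ Vec.lookup (Vec.lookup p v) i)

proper? : (p : Placement k n) → Dec (Proper p)
proper? p = All.all? (λ _ → ¬? (T? _)) _ ×-dec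
  all? λ i → any? λ u → any? λ v → ¬? (_ ℕ.≟ _)

placementCert : Placement k n → Cert
placementCert {k} {n} p = k , map (λ (u , v) → oneApart (Vec.lookup p u) (Vec.lookup p v)) (pairs n)

-- The search runs over labeled graphs, so every relabeling of a placement is required; the filter
-- supplies its proof of `Proper`.
placementCerts : Placement k n → List Cert
placementCerts p = map placementCert (filter proper? (permutations p))

bits : ∀ n → List (Vec Bool n)
bits zero    = [] ∷ []
bits (suc n) = map (true ∷_) (bits n) ++ map (false ∷_) (bits n)

NonConstant : Vec Bool n → Set
NonConstant s = ∃[ u ] ∃[ v ] Vec.lookup s u ≢ Vec.lookup s v

nonConstant? : (s : Vec Bool n) → Dec (NonConstant s)
nonConstant? s = any? λ u → any? λ v → ¬? (_ Bool.≟ _)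

-- No connected graph avoids crossing s, so any bound holds.
splitCert : ℕ → Vec Bool n → Cert
splitCert {n} target s =
  target , map (λ (u , v) → does (Vec.lookup s u Bool.≟ Vec.lookup s v)) (pairs n)

splitCerts : ℕ → ∀ n → List Cert
splitCerts target n = map (splitCert target) (filter nonConstant? (bits n))

certs : ℕ → List (∃[ k ] Placement k n) → List Cert
certs {n} target ps = splitCerts target n ++ concatMap (λ (_ , p) → placementCerts p) ps

pairs-complete : {u v : Fin n} → u Fin.< v → (u , v) ∈ pairs n
pairs-complete u<v = ∈-filter⁺ (λ (u , v) → u Fin.<? v)
  (∈-cartesianProduct⁺ (∈-allFin _) (∈-allFin _)) u<v

1≤md : 2 ≤ n → (G : Graph n) → Connected G → 1 ≤ md G
1≤md (s≤s (s≤s z≤n)) G conn = ≤md-labels G (λ _ → toℕ)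
  (λ _ → zero , λ { zero 0≢0 → ⊥-elim (0≢0 refl) }) (λ u≢v → zero , u≢v ∘ toℕ-injective)
  conn λ _ → zero , suc zero , λ ()

module _ (G : Graph n) (conn : Connected G) where
  open Graph G

  private
    allowed : (f : Fin n → Fin n → Bool) → Allowed G (pairs n) (map (λ (u , v) → f u v) (pairs n)) →
              ∀ {u v} → u ~ v → T (f u v) ⊎ T (f v u)
    allowed f al {u} {v} e = case <-cmp u v of λ
      { (tri< u<v _ _) → inj₁ (member (pairs n) al (pairs-complete u<v) e)
      ; (tri≈ _ refl _) → ⊥-elim (subst T (irrefl u) e)
      ; (tri> _ _ v<u) → inj₂ (member (pairs n) al (pairs-complete v<u) (subst T (symm u v) e)) }
      where
      member : ∀ ps → Allowed G ps (map (λ (u , v) → f u v) ps) → ∀ {u v} → (u , v) ∈ ps → u ~ v → T (f u v)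
      member (_ ∷ ps) (b , _)  (here refl) e = b e
      member (_ ∷ ps) (_ , al) (there p∈)  e = member ps al p∈ e

  ≤md-placement : (p : Placement k n) → Proper p →
    (∀ {u v} → u ~ v → T (oneApart (Vec.lookup p u) (Vec.lookup p v)) ⊎
                       T (oneApart (Vec.lookup p v) (Vec.lookup p u))) → k ≤ md G
  ≤md-placement {k} p (distinct , varies) fits = ≤md-labels G lab one differ conn varies
    where
    row : Fin n → Vec ℕ k
    row = Vec.lookup p

    lab : Fin k → Fin n → ℕ
    lab i u = Vec.lookup (row u) i

    one : ∀ {u v} → u ~ v → ∃[ i ] (∀ j → j ≢ i → lab j u ≡ lab j v)
    one {u} {v} e with fits e
    ... | inj₁ t = oneApart-sound (row u) (row v) t
    ... | inj₂ t with oneApart-sound (row v) (row u) t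
    ...   | i , agree = i , λ j j≢i → sym (agree j j≢i)

    differ : ∀ {u v} → u ≢ v → ∃[ i ] lab i u ≢ lab i v
    differ {u} {v} u≢v with <-cmp u v
    ... | tri< u<v _ _ = same-complete (row u) (row v) (All.lookup distinct (pairs-complete u<v))
    ... | tri≈ _ u≡v _ = ⊥-elim (u≢v u≡v)
    ... | tri> _ _ v<u with same-complete (row v) (row u) (All.lookup distinct (pairs-complete v<u))
    ...   | i , ≢ = i , ≢-sym ≢

  placement-valid : (p : Placement k n) → Proper p → ValidCert G (pairs n) (placementCert p)
  placement-valid p proper al =
    ≤md-placement p proper (allowed (λ u v → oneApart (Vec.lookup p u) (Vec.lookup p v)) al)

  split-valid : ∀ target (s : Vec Bool n) → NonConstant s → ValidCert G (pairs n) (splitCert target s)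
  split-valid target s (u , v , s-differs) al = ⊥-elim (s-differs (constant (conn u v)))
    where
    equal : ∀ {u v} → u ~ v → Vec.lookup s u ≡ Vec.lookup s v
    equal e with allowed (λ u v → does (Vec.lookup s u Bool.≟ Vec.lookup s v)) al e
    ... | inj₁ t = T-does⁻ (_ Bool.≟ _) t
    ... | inj₂ t = sym (T-does⁻ (_ Bool.≟ _) t)
    constant : ∀ {u v} → Star _~_ u v → Vec.lookup s u ≡ Vec.lookup s v
    constant ε       = refl
    constant (e ◅ s) = trans (equal e) (constant s)

  certs-valid : ∀ target ps → All (ValidCert G (pairs n)) (certs target ps)
  certs-valid target ps = All.++⁺
    (All.map⁺ (All.map (λ {s} → split-valid target s) (All.all-filter nonConstant? (bits n))))
    (All.concat⁺ (All.map⁺ (universal (λ (_ , p) →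
      All.map⁺ (All.map (λ {q} → placement-valid q) (All.all-filter proper? (permutations p)))) ps)))

search-bound : ∀ target (ps : List (∃[ k ] Placement k n)) → 2 ≤ n →
  (let t = trie (certs target ps)) → T (search target (length (pairs n)) t t) →
  (G : Graph n) → Connected G → Connected (∁ G) → target ≤ md G * md (∁ G)
search-bound {n} target ps 2≤n ok G conn conn′ = search-sound target
  (λ (e , e′) → proj₂ (complement⁻ (Graph.adj G) e′) e) 1≤G 1≤∁G (pairs n) ok
  (trie-valid G 1≤G (pairs n) (certs-valid G conn target ps))
  (trie-valid (∁ G) 1≤∁G (pairs n) (certs-valid (∁ G) conn′ target ps))
  where
  1≤G  = 1≤md 2≤n G conn
  1≤∁G = 1≤md 2≤n (∁ G) conn′

transpose : Vec (Vec ℕ n) k → ∃[ l ] Placement l n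
transpose {n} {k} ls = k , Vec.tabulate λ u → Vec.map (λ l → Vec.lookup l u) ls

opaque
  -- The path is the only candidate of order 4; the placement gives its three edges three colors.
  md-product₄ : (G : Graph 4) → Connected G → Connected (∁ G) → 9 ≤ md G * md (∁ G)
  md-product₄ = search-bound 9
    ((transpose ((0 ∷ 0 ∷ 0 ∷ 1 ∷ []) ∷ (0 ∷ 0 ∷ 1 ∷ 0 ∷ []) ∷ (0 ∷ 1 ∷ 0 ∷ 1 ∷ []) ∷ [])) ∷ [])
    (s≤s (s≤s z≤n)) _

  -- The pairs one apart form K₄ with a pendant edge and the house, a triangle on a side of a
  -- 4-cycle. The search finds G and its complement each inside a copy of one of these, unless one
  -- of the two is disconnected.
  md-product₅ : (G : Graph 5) → Connected G → Connected (∁ G) → 4 ≤ md G * md (∁ G)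
  md-product₅ = search-bound 4
    (transpose ((0 ∷ 0 ∷ 0 ∷ 0 ∷ 1 ∷ []) ∷ (0 ∷ 1 ∷ 2 ∷ 3 ∷ 0 ∷ []) ∷ []) ∷
     transpose ((0 ∷ 0 ∷ 0 ∷ 1 ∷ 1 ∷ []) ∷ (0 ∷ 1 ∷ 2 ∷ 0 ∷ 1 ∷ []) ∷ []) ∷ [])
    (s≤s (s≤s z≤n)) _

  -- The first four placements give `md` at least 2, the last four at least 3. The target is met as
  -- 2 · 2 or as 3 · 1.
  md-product₆ : (G : Graph 6) → Connected G → Connected (∁ G) → 3 ≤ md G * md (∁ G)
  md-product₆ = search-bound 3
    (transpose ((0 ∷ 0 ∷ 0 ∷ 0 ∷ 0 ∷ 1 ∷ []) ∷ (0 ∷ 1 ∷ 2 ∷ 3 ∷ 4 ∷ 0 ∷ []) ∷ []) ∷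
     transpose ((0 ∷ 0 ∷ 0 ∷ 0 ∷ 1 ∷ 1 ∷ []) ∷ (0 ∷ 1 ∷ 2 ∷ 3 ∷ 0 ∷ 1 ∷ []) ∷ []) ∷
     transpose ((0 ∷ 0 ∷ 0 ∷ 0 ∷ 1 ∷ 2 ∷ []) ∷ (0 ∷ 1 ∷ 2 ∷ 3 ∷ 0 ∷ 0 ∷ []) ∷ []) ∷
     transpose ((0 ∷ 0 ∷ 0 ∷ 1 ∷ 1 ∷ 1 ∷ []) ∷ (0 ∷ 1 ∷ 2 ∷ 0 ∷ 1 ∷ 2 ∷ []) ∷ []) ∷
     transpose ((0 ∷ 0 ∷ 0 ∷ 0 ∷ 0 ∷ 1 ∷ []) ∷ (0 ∷ 0 ∷ 0 ∷ 0 ∷ 1 ∷ 1 ∷ []) ∷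
                (0 ∷ 1 ∷ 2 ∷ 3 ∷ 0 ∷ 0 ∷ []) ∷ []) ∷
     transpose ((0 ∷ 0 ∷ 0 ∷ 0 ∷ 0 ∷ 1 ∷ []) ∷ (0 ∷ 0 ∷ 0 ∷ 1 ∷ 1 ∷ 0 ∷ []) ∷
                (0 ∷ 1 ∷ 2 ∷ 0 ∷ 1 ∷ 2 ∷ []) ∷ []) ∷
     transpose ((0 ∷ 0 ∷ 0 ∷ 0 ∷ 1 ∷ 1 ∷ []) ∷ (0 ∷ 0 ∷ 1 ∷ 1 ∷ 0 ∷ 0 ∷ []) ∷
                (0 ∷ 1 ∷ 0 ∷ 1 ∷ 0 ∷ 1 ∷ []) ∷ []) ∷
     transpose ((0 ∷ 0 ∷ 0 ∷ 0 ∷ 1 ∷ 2 ∷ []) ∷ (0 ∷ 0 ∷ 0 ∷ 1 ∷ 1 ∷ 1 ∷ []) ∷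
                (0 ∷ 1 ∷ 2 ∷ 0 ∷ 0 ∷ 0 ∷ []) ∷ []) ∷ [])
    (s≤s (s≤s z≤n)) _

-- Extremal graphs

~-sym : (G : Graph n) → ∀ {u v} → Graph._~_ G u v → Graph._~_ G v u
~-sym G {u} {v} = subst T (Graph.symm G u v)

hop : (G : Graph n) → ∀ u w {v} → Graph._~_ G u w → Star (Graph._~_ G) w v → Star (Graph._~_ G) u v
hop G u w e s = e ◅ s

connected-to : (G : Graph n) (r : Fin n) → (∀ v → Star (Graph._~_ G) v r) → Connected G
connected-to G r to u v = to u ◅◅ reverse (~-sym G) (to v)

indicator : {P : Set} → Dec P → ℕ
indicator P? = if does P? then 1 else 0

indicator-cong : {P Q : Set} (P? : Dec P) (Q? : Dec Q) → (P → Q) → (Q → P) →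
                 indicator P? ≡ indicator Q?
indicator-cong (yes _) (yes _) _  _    = refl
indicator-cong (yes p) (no ¬q) to _    = ⊥-elim (¬q (to p))
indicator-cong (no ¬p) (yes q) _  from = ⊥-elim (¬p (from q))
indicator-cong (no _)  (no _)  _  _    = refl

indicator-≢ : {P Q : Set} (P? : Dec P) (Q? : Dec Q) → P → ¬ Q → indicator P? ≢ indicator Q?
indicator-≢ (yes _) (yes q) _ ¬q = ⊥-elim (¬q q)
indicator-≢ (yes _) (no _)  _ _  = λ ()
indicator-≢ (no ¬p) _       p _  = ⊥-elim (¬p p)

-- A star centered at 0 with one edge subdivided: 1 hangs from 2. Being a tree it attains n - 1. In
-- the complement 0 has the single neighbor 1, and this pendant edge gets a second color.
module Broom (m : ℕ) where

  N : ℕ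
  N = 4 + m

  parent : Fin N → Fin N
  parent (suc zero) = suc (suc zero)
  parent _          = zero

  Child : Fin N → Fin N → Set
  Child u v = u ≢ zero × parent u ≡ v

  child? : ∀ u v → Dec (Child u v)
  child? u v = ¬? (u ≟ zero) ×-dec (parent u ≟ v)

  adj : Fin N → Fin N → Bool
  adj u v = does (child? u v) ∨ does (child? v u)

  parent-≢ : ∀ v → v ≢ zero → parent v ≢ v
  parent-≢ zero          v≢0 _  = v≢0 refl
  parent-≢ (suc zero)    _   ()
  parent-≢ (suc (suc v)) _   ()

  G : Graph N
  G = record
    { adj    = adj
    ; symm   = λ u v → ∨-comm (does (child? u v)) (does (child? v u))
    ; irrefl = λ v → let no-loop = dec-false (child? v v) λ (v≢0 , e) → parent-≢ v v≢0 e
                     in cong₂ _∨_ no-loop no-loop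
    }

  open Graph G using (_~_)
  open Graph (∁ G) using () renaming (_~_ to _~ᶜ_)

  up : ∀ v → v ≢ zero → v ~ parent v
  up v v≢0 = Equivalence.from (T-∨ {does (child? v (parent v))})
    (inj₁ (T-does⁺ (child? v (parent v)) (v≢0 , refl)))

  adj⁻ : ∀ u v → u ~ v → Child u v ⊎ Child v u
  adj⁻ u v e with Equivalence.to (T-∨ {does (child? u v)}) e
  ... | inj₁ t = inj₁ (T-does⁻ (child? u v) t)
  ... | inj₂ t = inj₂ (T-does⁻ (child? v u) t)

  connected : Connected G
  connected = connected-to G zero to
    where
    to : ∀ v → Star _~_ v zero
    to zero                = ε
    to (suc zero)          = hop G (suc zero) (suc (suc zero)) (up (suc zero) (λ ())) (to (suc (suc zero)))
    to (suc (suc zero))    = up (suc (suc zero)) (λ ()) ◅ ε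
    to (suc (suc (suc v))) = up (suc (suc (suc v))) (λ ()) ◅ ε

  co : ∀ u v → u ≢ v → ¬ Child u v → ¬ Child v u → u ~ᶜ v
  co u v u≢v ¬uv ¬vu = complement⁺ adj u≢v λ e → [ ¬uv , ¬vu ] (adj⁻ u v e)

  co-connected : Connected (∁ G)
  co-connected = connected-to (∁ G) (suc zero) to
    where
    three-one : ∀ v → suc (suc (suc v)) ~ᶜ suc zero
    three-one v = co (suc (suc (suc v))) (suc zero) (λ ()) (λ { (_ , ()) }) (λ { (_ , ()) })
    to : ∀ v → Star _~ᶜ_ v (suc zero)
    to zero                =
      co zero (suc zero) (λ ()) (λ { (0≢0 , _) → 0≢0 refl }) (λ { (_ , ()) }) ◅ ε
    to (suc zero)          = ε
    to (suc (suc zero))    = hop (∁ G) (suc (suc zero)) (suc (suc (suc zero)))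
      (co (suc (suc zero)) (suc (suc (suc zero))) (λ ()) (λ { (_ , ()) }) (λ { (_ , ()) }))
      (three-one zero ◅ ε)
    to (suc (suc (suc v))) = three-one v ◅ ε

  -- The part cut off from the center by deleting the edge from `suc j` to its parent; the depth is
  -- 2, so grandchildren do not arise.
  Below : Fin (3 + m) → Fin N → Set
  Below j v = v ≡ suc j ⊎ parent v ≡ suc j

  below? : ∀ j v → Dec (Below j v)
  below? j v = (v ≟ suc j) ⊎-dec (parent v ≟ suc j)

  mark : Fin (3 + m) → Fin N → ℕ
  mark j v = indicator (below? j v)

  mark-cong : ∀ j u v → (Below j u → Below j v) → (Below j v → Below j u) → mark j u ≡ mark j v
  mark-cong j u v = indicator-cong (below? j u) (below? j v)

  mark-≢ : ∀ j u v → Below j u → ¬ Below j v → mark j u ≢ mark j v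
  mark-≢ j u v = indicator-≢ (below? j u) (below? j v)

  parent² : ∀ v → parent (parent v) ≡ zero
  parent² zero          = refl
  parent² (suc zero)    = refl
  parent² (suc (suc v)) = refl

  child-single : ∀ u v → Child u v → ∃[ i ] (∀ j → j ≢ i → mark j u ≡ mark j v)
  child-single zero    v (0≢0 , _)  = ⊥-elim (0≢0 refl)
  child-single (suc i) v (_ , refl) = i , λ j j≢i → mark-cong j (suc i) (parent (suc i))
    [ (λ i≡j → ⊥-elim (j≢i (sym (suc-injective i≡j)))) , inj₁ ]
    [ inj₂ , (λ p → case trans (sym (parent² (suc i))) p of λ ()) ]

  ¬below-0 : ∀ j → ¬ Below j zero
  ¬below-0 j (inj₁ ())
  ¬below-0 j (inj₂ ())

  distinct : ∀ u v → u ≢ v → ∃[ j ] mark j u ≢ mark j v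
  distinct zero    zero    u≢v = ⊥-elim (u≢v refl)
  distinct zero    (suc j) u≢v = j , ≢-sym (mark-≢ j (suc j) zero (inj₁ refl) (¬below-0 j))
  distinct (suc i) zero    u≢v = i , mark-≢ i (suc i) zero (inj₁ refl) (¬below-0 i)
  distinct (suc i) (suc j) u≢v with parent (suc j) ≟ suc i
  ... | no ¬p = i , mark-≢ i (suc i) (suc j) (inj₁ refl) [ u≢v ∘ sym , ¬p ]
  ... | yes p = j , ≢-sym (mark-≢ j (suc j) (suc i) (inj₁ refl)
    [ u≢v , (λ q → case trans (sym (parent² (suc i))) (trans (cong parent q) p) of λ ()) ])

  lower : 3 + m ≤ md G
  lower = ≤md-labels G mark (λ {u} {v} → single u v) (λ {u} {v} → distinct u v) connected
    λ i → suc i , zero , mark-≢ i (suc i) zero (inj₁ refl) (¬below-0 i)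
    where
    single : ∀ u v → u ~ v → ∃[ i ] (∀ j → j ≢ i → mark j u ≡ mark j v)
    single u v e with adj⁻ u v e
    ... | inj₁ uv = child-single u v uv
    ... | inj₂ vu with child-single v u vu
    ...   | i , agree = i , λ j j≢i → sym (agree j j≢i)

  co-lower : 2 ≤ md (∁ G)
  co-lower = ≤md-labels (∁ G) lab (λ {u} {v} → single u v) (λ {u} {v} → differ u v) co-connected
    λ { zero → zero , suc zero , (λ ()) ; (suc zero) → suc zero , suc (suc zero) , (λ ()) }
    where
    -- Vertex 0 copies the second coordinate of vertex 1, its only neighbor in the complement.
    lab : Fin 2 → Fin N → ℕ
    lab zero       zero    = 1
    lab zero       (suc v) = 0
    lab (suc zero) zero    = 0
    lab (suc zero) (suc v) = toℕ v

    single : ∀ u v → u ~ᶜ v → ∃[ i ] (∀ j → j ≢ i → lab j u ≡ lab j v)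
    single zero          zero          e = zero , λ _ _ → refl
    single zero          (suc zero)    e = zero , λ { zero j≢0 → ⊥-elim (j≢0 refl) ; (suc zero) _ → refl }
    single (suc zero)    zero          e = zero , λ { zero j≢0 → ⊥-elim (j≢0 refl) ; (suc zero) _ → refl }
    single zero          (suc (suc v)) e = ⊥-elim (proj₂ (complement⁻ adj {zero} {suc (suc v)} e)
      (~-sym G {suc (suc v)} {zero} (up (suc (suc v)) (λ ()))))
    single (suc (suc u)) zero          e =
      ⊥-elim (proj₂ (complement⁻ adj {suc (suc u)} {zero} e) (up (suc (suc u)) (λ ())))
    single (suc u)       (suc v)       e = suc zero , λ
      { zero _ → refl ; (suc zero) j≢1 → ⊥-elim (j≢1 refl) }

    differ : ∀ u v → u ≢ v → ∃[ i ] lab i u ≢ lab i v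
    differ zero    zero    u≢v = ⊥-elim (u≢v refl)
    differ zero    (suc v) u≢v = zero , λ ()
    differ (suc u) zero    u≢v = zero , λ ()
    differ (suc u) (suc v) u≢v = suc zero , λ e → u≢v (cong suc (toℕ-injective e))

  product : 2 ≤ m → md G * md (∁ G) ≡ 2 * (3 + m)
  product 2≤m = ℕ.≤-antisym (upper-bound (md-product (s≤s (s≤s (s≤s (s≤s (≤-trans (s≤s z≤n) 2≤m)))))
      G connected co-connected))
    (subst (_≤ md G * md (∁ G)) (ℕ.*-comm (3 + m) 2) (ℕ.*-mono-≤ lower co-lower))
    where
    upper-bound : md G * md (∁ G) ≤ 9 ⊎ md G * md (∁ G) ≤ 2 * (3 + m) → md G * md (∁ G) ≤ 2 * (3 + m)
    -- m ≥ 2 means order at least 6, where 9 ≤ 2 (n - 1).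
    upper-bound (inj₁ ≤9) = ≤-trans ≤9 (≤-trans (ℕ.n≤1+n 9) (ℕ.*-monoʳ-≤ 2 (ℕ.+-monoʳ-≤ 3 2≤m)))
    upper-bound (inj₂ p)  = p

entry-sym : (t : Upper n) → ∀ u v → entry t u v ≡ entry t v u
entry-sym t       zero    zero    = refl
entry-sym t       zero    (suc v) = refl
entry-sym t       (suc u) zero    = refl
entry-sym (_ , t) (suc u) (suc v) = entry-sym t u v

entry-irrefl : (t : Upper n) → ∀ v → entry t v v ≡ false
entry-irrefl t       zero    = refl
entry-irrefl (_ , t) (suc v) = entry-irrefl t v

fromUpper : Upper n → Graph n
fromUpper t = record { adj = entry t ; symm = entry-sym t ; irrefl = entry-irrefl t }

-- Each edge {u , v} is listed as (u , v) with u < v.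
fromEdges : List (Fin n × Fin n) → Upper n
fromEdges {n} es = upper λ u v → does ((u , v) ∈ᵉ? es)
  where open DecMembership (≡-dec (_≟_ {n}) (_≟_ {n}))
          using () renaming (_∈?_ to _∈ᵉ?_)

Within : Adj n → ℕ → Fin n → Fin n → Set
Within a zero    u v = u ≡ v
Within a (suc k) u v = u ≡ v ⊎ ∃[ w ] (T (a u w) × Within a k w v)

within? : (a : Adj n) → ∀ k u v → Dec (Within a k u v)
within? a zero    u v = u ≟ v
within? a (suc k) u v = (u ≟ v) ⊎-dec any? λ w → T? (a u w) ×-dec within? a k w v

within⇒star : (a : Adj n) → ∀ k {u v} → Within a k u v → Star (λ u v → T (a u v)) u v
within⇒star a zero    refl                = ε
within⇒star a (suc k) (inj₁ refl)         = ε
within⇒star a (suc k) (inj₂ (w , e , s)) = e ◅ within⇒star a k s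

connected-within : (G : Graph (suc n)) → ∀ k → (∀ v → Within (Graph.adj G) k v zero) → Connected G
connected-within G k to = connected-to G zero λ v → within⇒star (Graph.adj G) k (to v)

md≤classes : (G : Graph n) → length (Forced.classes (Graph.adj G)) ≤ m → md G ≤ m
md≤classes G ≤m = md≤ G λ c c-md →
  Forced.Sound.atMost-classes (Graph.adj G) (structure c c-md) ((λ e → e) , λ e → e) ≤m

md≤pentagon : (G : Graph n) → Forced.Pentagon (Graph.adj G) → md G ≤ 2
md≤pentagon G pent = md≤ G λ c c-md →
  Forced.Sound.atMost-pentagon (Graph.adj G) (structure c c-md) ((λ e → e) , λ e → e) pent

Attained : ℕ → ℕ → Set
Attained n x = Σ[ G ∈ Graph n ] Connected G × Connected (∁ G) × md G * md (∁ G) ≡ x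

md₄ : (G : Graph 4) → Connected G → Connected (∁ G) → md G * md (∁ G) ≡ 9
md₄ G conn conn′ = ℕ.≤-antisym
  (ℕ.*-mono-≤ (md-connected G conn) (md-connected (∁ G) conn′)) (md-product₄ G conn conn′)

path₄ : Attained 4 9
path₄ = G , conn , conn′ , md₄ G conn conn′
  where
  G = fromUpper (fromEdges {4} ((0F , 1F) ∷ (1F , 2F) ∷ (2F , 3F) ∷ []))
  conn  = connected-within G 3 (from-yes (all? λ v → within? (Graph.adj G) 3 v zero))
  conn′ = connected-within (∁ G) 3 (from-yes (all? λ v → within? (Graph.adj (∁ G)) 3 v zero))

cycle₅ : Attained 5 4
cycle₅ = G , conn , conn′ , ℕ.≤-antisym
  (ℕ.*-mono-≤ (md≤pentagon G (from-yes (Forced.pentagon? (Graph.adj G))))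
              (md≤pentagon (∁ G) (from-yes (Forced.pentagon? (Graph.adj (∁ G))))))
  (md-product₅ G conn conn′)
  where
  G = fromUpper (fromEdges {5} ((0F , 1F) ∷ (1F , 2F) ∷ (2F , 3F) ∷ (3F , 4F) ∷ (0F , 4F) ∷ []))
  conn  = connected-within G 2 (from-yes (all? λ v → within? (Graph.adj G) 2 v zero))
  conn′ = connected-within (∁ G) 2 (from-yes (all? λ v → within? (Graph.adj (∁ G)) 2 v zero))

Fits : Adj n → Placement k n → Set
Fits a p = ∀ u v → T (a u v) → T (oneApart (Vec.lookup p u) (Vec.lookup p v))

fits? : (a : Adj n) (p : Placement k n) → Dec (Fits a p)
fits? a p = all? λ u → all? λ v → T? _ →-dec T? _

md₅≤9 : (G : Graph 5) → Connected G → Connected (∁ G) → md G * md (∁ G) ≤ 9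
md₅≤9 G conn conn′ =
  [ (λ p → p) , (λ p → ≤-trans p (ℕ.n≤1+n 8)) ] (md-product ≤-refl G conn conn′)

-- The bull is self-complementary: its two pendant edges and its triangle carry one color each. A
-- pendant vertex copies the last coordinate of its neighbor.
bull : Attained 5 9
bull = G , conn , conn′ , ℕ.≤-antisym (md₅≤9 G conn conn′) (ℕ.*-mono-≤
  (≤md-placement G conn p (from-yes (proper? p)) (λ {u} {v} →
    inj₁ ∘ from-yes (fits? (Graph.adj G) p) u v))
  (≤md-placement (∁ G) conn′ q (from-yes (proper? q)) (λ {u} {v} →
    inj₁ ∘ from-yes (fits? (Graph.adj (∁ G)) q) u v)))
  where
  G = fromUpper (fromEdges {5} ((0F , 1F) ∷ (1F , 2F) ∷ (0F , 2F) ∷ (0F , 3F) ∷ (1F , 4F) ∷ []))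
  conn  = connected-within G 2 (from-yes (all? λ v → within? (Graph.adj G) 2 v zero))
  conn′ = connected-within (∁ G) 3 (from-yes (all? λ v → within? (Graph.adj (∁ G)) 3 v zero))
  p = proj₂ (transpose ((0 ∷ 0 ∷ 0 ∷ 1 ∷ 0 ∷ []) ∷ (0 ∷ 0 ∷ 0 ∷ 0 ∷ 1 ∷ []) ∷
                        (0 ∷ 1 ∷ 2 ∷ 0 ∷ 1 ∷ []) ∷ []))
  q = proj₂ (transpose ((1 ∷ 0 ∷ 0 ∷ 0 ∷ 0 ∷ []) ∷ (0 ∷ 1 ∷ 0 ∷ 0 ∷ 0 ∷ []) ∷
                        (2 ∷ 1 ∷ 0 ∷ 1 ∷ 2 ∷ []) ∷ []))

-- The complement is K₄ minus an edge with a path of two edges attached at 0, so it has three forced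
-- classes, while all edges of G form one.
two-colors₆ : Attained 6 3
two-colors₆ = G , conn , conn′ , ℕ.≤-antisym
  (ℕ.*-mono-≤ md≤1 md≤3)
  (md-product₆ G conn conn′)
  where
  G = fromUpper (fromEdges {6} ((0F , 1F) ∷ (0F , 3F) ∷ (1F , 3F) ∷ (1F , 4F) ∷ (1F , 5F) ∷
                                (2F , 3F) ∷ (2F , 4F) ∷ (2F , 5F) ∷ []))
  conn  = connected-within G 2 (from-yes (all? λ v → within? (Graph.adj G) 2 v zero))
  conn′ = connected-within (∁ G) 2 (from-yes (all? λ v → within? (Graph.adj (∁ G)) 2 v zero))

  md≤1 : md G ≤ 1
  md≤1 = md≤classes G ≤-refl

  md≤3 : md (∁ G) ≤ 3
  md≤3 = md≤classes (∁ G) ≤-refl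

-- What a blow-up needs: `one-class` makes each copy of a monochromatic, and `disjoint` leaves a
-- common edge when a copy is changed in two fibers, so that all copies share one color.
record Rigid (a : Adj (suc k)) : Set where
  field
    a-irrefl     : ∀ v → ¬ T (a v v)
    one-class    : length (Forced.classes a) ≤ 1
    reach-zero   : ∀ v → Within a 2 v zero
    neighbor     : ∀ u → ∃[ v ] T (a u v)
    disjoint     : ∀ u v → ∃[ w ] ∃[ z ] T (a w z) × (w ≢ u × w ≢ v) × (z ≢ u × z ≢ v)

rigid? : (a : Adj (suc k)) → Dec (Rigid a)
rigid? a = map′
  (λ (i , o , r , n , d) → record
    { a-irrefl = i ; one-class = o ; reach-zero = r ; neighbor = n ; disjoint = d })
  (λ r → let open Rigid r in a-irrefl , one-class , reach-zero , neighbor , disjoint)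
  ((all? λ v → ¬? (T? _)) ×-dec (_ ℕ.≤? 1) ×-dec (all? λ v → within? a 2 v zero) ×-dec
   (all? λ u → any? λ v → T? _) ×-dec
   (all? λ u → all? λ v → any? λ w → any? λ z → T? _ ×-dec
      (¬? (w ≟ u) ×-dec ¬? (w ≟ v)) ×-dec (¬? (z ≟ u) ×-dec ¬? (z ≟ v))))

-- H arises from the rigid graph a by replacing each vertex c with the fiber φ⁻¹(c).
module BlowUp {a : Adj (suc k)} (rigid : Rigid a) (φ : Fin n → Fin (suc k)) (can : Fin (suc k) → Fin n)
  (φ-can : ∀ c → φ (can c) ≡ c) (H : Graph n)
  (across : ∀ {u v} → φ u ≢ φ v →
    (Graph._~_ H u v → T (a (φ u) (φ v))) × (T (a (φ u) (φ v)) → Graph._~_ H u v))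
  where
  open Graph H
  open Rigid rigid

  edge⇒≢ : ∀ {c d} → T (a c d) → c ≢ d
  edge⇒≢ e refl = a-irrefl _ e

  lift : ∀ {u v c d} → φ u ≡ c → φ v ≡ d → T (a c d) → u ~ v
  lift refl refl e = proj₂ (across (edge⇒≢ e)) e

  connected : Connected H
  connected = connected-to H (can zero) λ u → case neighbor (φ u) of λ
    { (b , e) → hop H u (can b) (lift refl (φ-can b) e)
        (gmap can (λ {c} {d} → lift (φ-can c) (φ-can d)) (within⇒star a 2 (reach-zero b))) }

  module _ {l} (c : EdgeColoring H l) (c-md : IsMDColoring c) where
    private
      M = structure c c-md
    open MDStructure M using (col; col-sym; col-flip; triangle′)

    -- One vertex from each fiber spans a copy of a, whatever the adjacency inside the fibers.
    module Section (s : Fin (suc k) → Fin n) (φ-s : ∀ c → φ (s c) ≡ c) where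

      s-injective : ∀ {c d} → s c ≡ s d → c ≡ d
      s-injective {c} {d} e = trans (sym (φ-s c)) (trans (cong φ e) (φ-s d))

      realizes : restrict s s-injective M Realizes a
      realizes {c} {d} = (λ e → subst₂ (λ c d → T (a c d)) (φ-s c) (φ-s d)
          (proj₁ (across (λ eq → MDStructure.~⇒≢ M e (cong s (trans (sym (φ-s c)) (trans eq (φ-s d)))))) e)) ,
        lift (φ-s c) (φ-s d)

      monochromatic : ∀ {c d c′ d′} → T (a c d) → T (a c′ d′) → col (s c) (s d) ≡ col (s c′) (s d′)
      monochromatic e e′ with Forced.Sound.atMost-classes a (restrict s s-injective M) realizes one-class
      ... | []     , _ , covers = case covers _ _ (lift (φ-s _) (φ-s _) e) of λ ()
      ... | x ∷ [] , _ , covers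
        with covers _ _ (lift (φ-s _) (φ-s _) e) | covers _ _ (lift (φ-s _) (φ-s _) e′)
      ...   | here p | here q = trans p (sym q)
      monochromatic e e′ | x ∷ y ∷ L , s≤s () , _

    base : ∃[ v ] T (a zero v)
    base = neighbor zero

    κ : ℕ
    κ = col (can zero) (can (proj₁ base))

    -- A section through u and v shares an edge with can.
    across-κ : ∀ {u v} → φ u ≢ φ v → u ~ v → col u v ≡ κ
    across-κ {u} {v} φu≢φv uv with disjoint (φ u) (φ v)
    ... | w , z , wz , (w≢u , w≢v) , (z≢u , z≢v) =
      trans (cong₂ col (sym s-u) (sym s-v))
        (trans (Section.monochromatic s φ-s (proj₁ (across φu≢φv) uv) wz)
          (trans (cong₂ col (s-off w≢u w≢v) (s-off z≢u z≢v))
            (Section.monochromatic can φ-can wz (proj₂ base))))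
      where
      s : Fin (suc k) → Fin n
      s c with c ≟ φ u | c ≟ φ v
      ... | yes _ | _     = u
      ... | no _  | yes _ = v
      ... | no _  | no _  = can c

      φ-s : ∀ c → φ (s c) ≡ c
      φ-s c with c ≟ φ u | c ≟ φ v
      ... | yes e | _     = sym e
      ... | no _  | yes e = sym e
      ... | no _  | no _  = φ-can c

      s-u : s (φ u) ≡ u
      s-u with φ u ≟ φ u
      ... | yes _ = refl
      ... | no ¬e = ⊥-elim (¬e refl)

      s-v : s (φ v) ≡ v
      s-v with φ v ≟ φ u | φ v ≟ φ v
      ... | yes e | _     = ⊥-elim (φu≢φv (sym e))
      ... | no _  | yes _ = refl
      ... | no _  | no ¬e = ⊥-elim (¬e refl)

      s-off : ∀ {c} → c ≢ φ u → c ≢ φ v → s c ≡ can c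
      s-off {c} c≢u c≢v with c ≟ φ u | c ≟ φ v
      ... | yes e | _     = ⊥-elim (c≢u e)
      ... | no _  | yes e = ⊥-elim (c≢v e)
      ... | no _  | no _  = refl

    atMost-one : MDStructure.AtMost M 1
    atMost-one = κ ∷ [] , ≤-refl , λ u v uv → here (all-κ u v uv)
      where
      all-κ : ∀ u v → u ~ v → col u v ≡ κ
      all-κ u v uv with φ u ≟ φ v
      ... | no φu≢φv = across-κ φu≢φv uv
      -- An edge inside a fiber closes a triangle with any vertex of a neighboring fiber.
      ... | yes φu≡φv with neighbor (φ u)
      ...   | b , e = trans (triangle′ uv vw uw) (across-κ (λ eq → edge⇒≢ e (trans eq (φ-can b))) uw)
        where
        uw : u ~ can b
        uw = lift refl (φ-can b) e
        vw : v ~ can b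
        vw = lift (sym φu≡φv) (φ-can b) e

  md≤1 : md H ≤ 1
  md≤1 = md≤ H atMost-one

-- Both a and its complement are rigid. The m extra vertices copy vertex 6, in a fiber independent
-- in G and complete in its complement; `BlowUp` accepts both, since `across` only concerns
-- different fibers.
module Rigid₇ (m : ℕ) where

  t : Upper 7
  t = fromEdges ((0F , 2F) ∷ (0F , 4F) ∷ (0F , 6F) ∷ (1F , 2F) ∷ (1F , 3F) ∷ (1F , 5F) ∷
                        (2F , 4F) ∷ (3F , 4F) ∷ (3F , 6F) ∷ (4F , 5F) ∷ [])

  a : Adj 7
  a = entry t

  φ : Fin (7 + m) → Fin 7
  φ = [ (λ c → c) , const 6F ] ∘ splitAt 7

  φ-can : ∀ c → φ (c ↑ˡ m) ≡ c
  φ-can c = cong [ (λ c → c) , const 6F ] (splitAt-↑ˡ 7 c m)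

  G : Graph (7 + m)
  G = record
    { adj    = λ u v → a (φ u) (φ v)
    ; symm   = λ u v → entry-sym t (φ u) (φ v)
    ; irrefl = λ v → entry-irrefl t (φ v)
    }

  module B = BlowUp (from-yes (rigid? a)) φ (_↑ˡ m) φ-can G (λ _ → (λ e → e) , (λ e → e))

  module B′ = BlowUp (from-yes (rigid? (complement a))) φ (_↑ˡ m) φ-can (∁ G) (λ {u} {v} φu≢φv →
    (λ e → complement⁺ a φu≢φv (proj₂ (complement⁻ (Graph.adj G) {u} {v} e))) ,
    λ e → complement⁺ (Graph.adj G) {u} {v} (φu≢φv ∘ cong φ) (proj₂ (complement⁻ a {φ u} {φ v} e)))

  attained : Attained (7 + m) 1
  attained = G , B.connected , B′.connected , ℕ.≤-antisym
    (ℕ.*-mono-≤ B.md≤1 B′.md≤1)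
    (ℕ.*-mono-≤ (1≤md (s≤s (s≤s z≤n)) G B.connected) (1≤md (s≤s (s≤s z≤n)) (∁ G) B′.connected))

9≤2⟨n-1⟩ : 6 ≤ n → 9 ≤ 2 * (n ∸ 1)
9≤2⟨n-1⟩ 6≤n = ≤-trans (ℕ.n≤1+n 9) (ℕ.*-monoʳ-≤ 2 (ℕ.∸-monoˡ-≤ 1 6≤n))

md-product≤ : 6 ≤ n → (G : Graph n) → Connected G → Connected (∁ G) → md G * md (∁ G) ≤ 2 * (n ∸ 1)
md-product≤ 6≤n G conn conn′ =
  [ (λ p → ≤-trans p (9≤2⟨n-1⟩ 6≤n)) , (λ p → p) ] (md-product (≤-trans (ℕ.n≤1+n 5) 6≤n) G conn conn′)

broom : ∀ m → 2 ≤ m → Attained (4 + m) (2 * (3 + m))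
broom m 2≤m = G , connected , co-connected , product 2≤m
  where open Broom m

theorem4p4 : ((n : ℕ) → 4 ≤ n → (G : Graph n) → Connected G → Connected (∁ G) →
    (n ≡ 4 → md G * md (∁ G) ≡ 9)
    × (n ≡ 5 → 4 ≤ md G * md (∁ G) × md G * md (∁ G) ≤ 9)
    × (n ≡ 6 → 3 ≤ md G * md (∁ G) × md G * md (∁ G) ≤ 10)
    × (7 ≤ n → 1 ≤ md G * md (∁ G) × md G * md (∁ G) ≤ 2 * (n ∸ 1)))
    × (Σ[ G ∈ Graph 4 ] Connected G × Connected (∁ G) × md G * md (∁ G) ≡ 9)
    × (Σ[ G ∈ Graph 5 ] Connected G × Connected (∁ G) × md G * md (∁ G) ≡ 4)
    × (Σ[ G ∈ Graph 5 ] Connected G × Connected (∁ G) × md G * md (∁ G) ≡ 9)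
    × (Σ[ G ∈ Graph 6 ] Connected G × Connected (∁ G) × md G * md (∁ G) ≡ 3)
    × (Σ[ G ∈ Graph 6 ] Connected G × Connected (∁ G) × md G * md (∁ G) ≡ 10)
    × ((n : ℕ) → 7 ≤ n →
    (Σ[ G ∈ Graph n ] Connected G × Connected (∁ G) × md G * md (∁ G) ≡ 1)
    × (Σ[ G ∈ Graph n ] Connected G × Connected (∁ G) × md G * md (∁ G) ≡ 2 * (n ∸ 1)))
theorem4p4 =
  (λ n 4≤n G conn conn′ →
    (λ { refl → md₄ G conn conn′ }) ,
    (λ { refl → md-product₅ G conn conn′ , md₅≤9 G conn conn′ }) ,
    (λ { refl → md-product₆ G conn conn′ , md-product≤ ≤-refl G conn conn′ }) ,
    (λ 7≤n → ℕ.*-mono-≤ (1≤md (≤-trans (s≤s (s≤s z≤n)) 4≤n) G conn)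
                        (1≤md (≤-trans (s≤s (s≤s z≤n)) 4≤n) (∁ G) conn′) ,
             md-product≤ (≤-trans (ℕ.n≤1+n 6) 7≤n) G conn conn′)) ,
  path₄ , cycle₅ , bull , two-colors₆ , broom 2 ≤-refl , λ n 7≤n → sharp (ℕ.m≤n⇒∃[o]m+o≡n 7≤n)
  where
  sharp : ∀ {n} → ∃[ m ] 7 + m ≡ n → Attained n 1 × Attained n (2 * (n ∸ 1))
  sharp (m , refl) = Rigid₇.attained m , broom (3 + m) (s≤s (s≤s z≤n))
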